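{- Let $G$ be an extraspecial $2$-group of order $2^{2m+1}$ ($m\geqslant 1$) and let $H\leqslant G$. Then $H$ is a perfect code of $G$ if and only if one of the following holds: $H$ is non-abelian; or $H$ is abelian and $H$ is not normal in $G$; or $H$ is a maximal abelian subgroup of $G$ and $G\cong G_{m,1}$.
   Context: All groups are finite; all graphs are finite, undirected and simple. For a group $G$ and an inverse-closed subset $S\subseteq G\setminus\{1\}$, the Cayley graph $\mathrm{Cay}(G,S)$ has vertex set $G$, with $x,y\in G$ adjacent if and only if $yx^{ -1}\in S$. A subset $C$ of the vertex set of a graph $\Gamma$ is a perfect code in $\Gamma$ if $C$ is an independent set and every vertex of $\Gamma$ is at distance at most $1$ from exactly one vertex of $C$. A subgroup $H$ of a group $G$ is called a perfect code of $G$ if there exists a Cayley graph $\mathrm{Cay}(G,S)$ of $G$ in which $H$ is a perfect code. A finite $2$-group $G$ is extraspecial if its center $Z(G)$ has order $2$ and $G/Z(G)$ is a (nontrivial) elementary abelian $2$-group; then $|G|=2^{2m+1}$ for some positive integer $m$. For a positive integer $m$, $G_{m,1}$ denotes the central product $D_8\circ\cdots\circ D_8$ of $m$ copies of the dihedral group $D_8$ of order $8$, with all the centers (of order $2$) identified; it is extraspecial of order $2^{2m+1}$. A maximal abelian subgroup of $G$ is an abelian subgroup not properly contained in any other abelian subgroup of $G$.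
   Formalization: H is assumed nontrivial: H = 1 is a perfect code (take S = G∖{1}) but is abelian, normal and not maximal abelian, so the statement fails there. Membership in H is also assumed decidable, which excluded middle supplies. -}

module Defs where

open import Algebra.Bundles using (Group)
import Algebra.Construct.Pointwise as Pointwise
import Algebra.Definitions.RawMonoid as RawMonoidDefinitions
open import Algebra.Morphism.Structures using (IsGroupIsomorphism)
import Algebra.Properties.Group as GroupProperties
open import Data.Bool.Base using (Bool; true; false; _xor_)
import Data.Bool.Properties as Bool
open import Data.Fin.Base using (Fin; zero; suc; toℕ)
open import Data.Fin.Patterns using (0F; 1F; 2F; 3F)
import Data.Fin.Properties as Fin
open import Data.Nat.Base using (ℕ; zero; suc; _≤_; _+_; _*_; _^_)
open import Data.Nat.DivMod using (_mod_)
open import Data.Product.Base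
  using (∃; ∃-syntax; Σ-syntax; _×_; _,_; proj₁; proj₂)
open import Data.Product using (∃!)
open import Data.Product.Properties using (≡-dec)
open import Data.Vec.Functional using (Vector)
open import Function.Base using (_∘_)
open import Function.Bundles using (Inverse)
open import Level using (Level; 0ℓ; _⊔_) renaming (suc to lsuc)
open import Relation.Binary.Bundles using (Setoid)
import Relation.Binary.Construct.On as On
open import Relation.Binary.Definitions using (_Respects_; _Respects₂_; Symmetric)
open import Relation.Binary.PropositionalEquality as ≡ using (_≡_)
import Relation.Binary.Reasoning.Setoid as ≈-Reasoning
open import Relation.Nullary using (¬_)
open import Relation.Nullary.Decidable using (Dec; map′; _×-dec_; toWitness)
open import Relation.Unary using (Pred; _∈_; _∉_; _⊂_; Decidable)

private
  variable
    c ℓ c′ ℓ′ v e p : Level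

------------------------------------------------------------------------
-- Cardinality

HasCardinality : Setoid c ℓ → ℕ → Set (c ⊔ ℓ)
HasCardinality S n = Inverse S (≡.setoid (Fin n))

------------------------------------------------------------------------
-- Simple graphs and perfect codes

record Graph v ℓ e : Set (lsuc (v ⊔ ℓ ⊔ e)) where
  field
    vertices   : Setoid v ℓ
  open Setoid vertices public
    using (_≈_) renaming (Carrier to Vertex)
  field
    Adj        : Vertex → Vertex → Set e
    Adj-resp-≈ : Adj Respects₂ _≈_
    Adj-sym    : Symmetric Adj
    Adj-irrefl : ∀ {x} → ¬ Adj x x

module _ (Γ : Graph v ℓ e) where
  open Graph Γ

  data Walk : Vertex → Vertex → ℕ → Set (v ⊔ ℓ ⊔ e) where
    stop : ∀ {x y} → x ≈ y → Walk x y 0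
    step : ∀ {x y z n} → Adj x y → Walk y z n → Walk x z (suc n)

  DistanceAtMost : ℕ → Vertex → Vertex → Set (v ⊔ ℓ ⊔ e)
  DistanceAtMost k x y = ∃[ n ] n ≤ k × Walk x y n

  IsIndependent : Pred Vertex p → Set (v ⊔ e ⊔ p)
  IsIndependent C = ∀ {x y} → x ∈ C → y ∈ C → ¬ Adj x y

  IsPerfectCode : Pred Vertex p → Set (v ⊔ ℓ ⊔ e ⊔ p)
  IsPerfectCode C =
    IsIndependent C ×
    (∀ x → ∃! _≈_ λ y → y ∈ C × DistanceAtMost 1 x y)

------------------------------------------------------------------------
-- Subgroups, Cayley graphs, extraspecial groups

module _ (G : Group c ℓ) where
  open Group G

  -- Membership is not required to be decidable here; on a finite group
  -- the subsets of classical mathematics are the decidable ones.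
  record Subgroup : Set (lsuc (c ⊔ ℓ)) where
    field
      member    : Pred Carrier (c ⊔ ℓ)
      resp      : member Respects _≈_
      ε-closed  : ε ∈ member
      ∙-closed  : ∀ {x y} → x ∈ member → y ∈ member → x ∙ y ∈ member
      ⁻¹-closed : ∀ {x} → x ∈ member → x ⁻¹ ∈ member

  record ConnectionSet : Set (lsuc (c ⊔ ℓ)) where
    field
      member    : Pred Carrier (c ⊔ ℓ)
      resp      : member Respects _≈_
      ε-∉       : ε ∉ member
      ⁻¹-closed : ∀ {x} → x ∈ member → x ⁻¹ ∈ member

open Subgroup using (member)

module _ {G : Group c ℓ} where
  open Group G

  -- The trivial subgroup is a perfect code of every finite group (take S
  -- to be all non-identity elements), although in an extraspecial group it
  -- is abelian, normal and not maximal abelian.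
  IsNontrivial : Subgroup G → Set (c ⊔ ℓ)
  IsNontrivial H = ∃[ x ] x ∈ member H × ¬ x ≈ ε

  IsAbelian : Subgroup G → Set (c ⊔ ℓ)
  IsAbelian H = ∀ {x y} → x ∈ member H → y ∈ member H → x ∙ y ≈ y ∙ x

  IsNormal : Subgroup G → Set (c ⊔ ℓ)
  IsNormal H = ∀ g {x} → x ∈ member H → g ∙ x ∙ g ⁻¹ ∈ member H

  IsMaximalAbelian : Subgroup G → Set (lsuc (c ⊔ ℓ))
  IsMaximalAbelian H =
    IsAbelian H ×
    ¬ (Σ[ K ∈ Subgroup G ] IsAbelian K × member H ⊂ member K)

module _ (G : Group c ℓ) where
  open Group G
  open GroupProperties G
  open ≈-Reasoning setoid

  Cay : ConnectionSet G → Graph c ℓ (c ⊔ ℓ)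
  Cay S = record
    { vertices   = setoid
    ; Adj        = λ x y → y ∙ x ⁻¹ ∈ S.member
    ; Adj-resp-≈ = (λ y≈y′ → S.resp (∙-congʳ y≈y′))
                 , (λ x≈x′ → S.resp (∙-congˡ (⁻¹-cong x≈x′)))
    ; Adj-sym    = λ {x} {y} s → S.resp (⁻¹-anti-homo-// y x) (S.⁻¹-closed s)
    ; Adj-irrefl = λ {x} s → S.ε-∉ (S.resp (inverseʳ x) s)
    }
    where module S = ConnectionSet S

  IsSubgroupPerfectCode : Subgroup G → Set (lsuc (c ⊔ ℓ))
  IsSubgroupPerfectCode H =
    Σ[ S ∈ ConnectionSet G ] IsPerfectCode (Cay S) (member H)

  private
    conj-central : ∀ g {x} → g ∙ x ≈ x ∙ g → g ∙ x ∙ g ⁻¹ ≈ x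
    conj-central g {x} gx≈xg = trans (∙-congʳ gx≈xg) (//-rightDividesʳ g x)

    comm-∙ : ∀ {x y z} → x ∙ z ≈ z ∙ x → y ∙ z ≈ z ∙ y →
             x ∙ y ∙ z ≈ z ∙ (x ∙ y)
    comm-∙ {x} {y} {z} xz yz = begin
      x ∙ y ∙ z    ≈⟨ assoc x y z ⟩
      x ∙ (y ∙ z)  ≈⟨ ∙-congˡ yz ⟩
      x ∙ (z ∙ y)  ≈⟨ assoc x z y ⟨
      x ∙ z ∙ y    ≈⟨ ∙-congʳ xz ⟩
      z ∙ x ∙ y    ≈⟨ assoc z x y ⟩
      z ∙ (x ∙ y)  ∎

    comm-⁻¹ : ∀ {x z} → x ∙ z ≈ z ∙ x → x ⁻¹ ∙ z ≈ z ∙ x ⁻¹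
    comm-⁻¹ {x} {z} xz = ∙-cancelˡ x _ _ (begin
      x ∙ (x ⁻¹ ∙ z)  ≈⟨ \\-leftDividesˡ x z ⟩
      z               ≈⟨ conj-central x xz ⟨
      x ∙ z ∙ x ⁻¹    ≈⟨ assoc x z (x ⁻¹) ⟩
      x ∙ (z ∙ x ⁻¹)  ∎)

  centre : Subgroup G
  centre = record
    { member    = λ x → ∀ y → x ∙ y ≈ y ∙ x
    ; resp      = λ x≈x′ xy y → trans (∙-congʳ (sym x≈x′)) (trans (xy y) (∙-congˡ x≈x′))
    ; ε-closed  = λ y → trans (identityˡ y) (sym (identityʳ y))
    ; ∙-closed  = λ xz yz z → comm-∙ (xz z) (yz z)
    ; ⁻¹-closed = λ xz z → comm-⁻¹ (xz z)
    }

  centre-normal : IsNormal centre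
  centre-normal g {x} xy =
    Subgroup.resp centre (sym (conj-central g (sym (xy g)))) xy

  -- G / N has the elements of G, with x and y equal when N x = N y.
  quotient : (N : Subgroup G) → IsNormal N → Group c (c ⊔ ℓ)
  quotient N normal = record
    { Carrier = Carrier
    ; _≈_     = λ x y → x ∙ y ⁻¹ ∈ N.member
    ; _∙_     = _∙_
    ; ε       = ε
    ; _⁻¹     = _⁻¹
    ; isGroup = record
      { isMonoid = record
        { isSemigroup = record
          { isMagma = record
            { isEquivalence = record
              { refl  = λ {x} → lift refl
              ; sym   = λ {x} {y} n → N.resp (⁻¹-anti-homo-// x y) (N.⁻¹-closed n)
              ; trans = λ {x} {y} {z} m n → N.resp (telescope x y z) (N.∙-closed m n)
              }
            ; ∙-cong = λ {x} {y} {u} {w} m n →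
                N.resp (∙-cong-eq x y u w) (N.∙-closed (normal x n) m)
            }
          ; assoc = λ x y z → lift (assoc x y z)
          }
        ; identity = (λ x → lift (identityˡ x)) , (λ x → lift (identityʳ x))
        }
      ; inverse = (λ x → lift (inverseˡ x)) , (λ x → lift (inverseʳ x))
      ; ⁻¹-cong = λ {x} {y} m →
          N.resp (⁻¹-cong-eq x y) (N.⁻¹-closed (normal (x ⁻¹) m))
      }
    }
    where
    module N = Subgroup N

    lift : ∀ {x y} → x ≈ y → x ∙ y ⁻¹ ∈ N.member
    lift x≈y = N.resp (sym (x≈y⇒x∙y⁻¹≈ε x≈y)) N.ε-closed

    telescope : ∀ x y z → x ∙ y ⁻¹ ∙ (y ∙ z ⁻¹) ≈ x ∙ z ⁻¹
    telescope x y z = begin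
      x ∙ y ⁻¹ ∙ (y ∙ z ⁻¹)    ≈⟨ assoc x (y ⁻¹) (y ∙ z ⁻¹) ⟩
      x ∙ (y ⁻¹ ∙ (y ∙ z ⁻¹))  ≈⟨ ∙-congˡ (\\-leftDividesʳ y (z ⁻¹)) ⟩
      x ∙ z ⁻¹                 ∎

    ∙-cong-eq : ∀ x y u w →
      x ∙ (u ∙ w ⁻¹) ∙ x ⁻¹ ∙ (x ∙ y ⁻¹) ≈ x ∙ u ∙ (y ∙ w) ⁻¹
    ∙-cong-eq x y u w = begin
      x ∙ (u ∙ w ⁻¹) ∙ x ⁻¹ ∙ (x ∙ y ⁻¹)  ≈⟨ telescope (x ∙ (u ∙ w ⁻¹)) x y ⟩
      x ∙ (u ∙ w ⁻¹) ∙ y ⁻¹               ≈⟨ ∙-congʳ (assoc x u (w ⁻¹)) ⟨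
      x ∙ u ∙ w ⁻¹ ∙ y ⁻¹                 ≈⟨ assoc (x ∙ u) (w ⁻¹) (y ⁻¹) ⟩
      x ∙ u ∙ (w ⁻¹ ∙ y ⁻¹)               ≈⟨ ∙-congˡ (⁻¹-anti-homo-∙ y w) ⟨
      x ∙ u ∙ (y ∙ w) ⁻¹                  ∎

    ⁻¹-cong-eq : ∀ x y →
      (x ⁻¹ ∙ (x ∙ y ⁻¹) ∙ x ⁻¹ ⁻¹) ⁻¹ ≈ x ⁻¹ ∙ y ⁻¹ ⁻¹
    ⁻¹-cong-eq x y = begin
      (x ⁻¹ ∙ (x ∙ y ⁻¹) ∙ x ⁻¹ ⁻¹) ⁻¹
        ≈⟨ ⁻¹-cong (∙-congʳ (\\-leftDividesʳ x (y ⁻¹))) ⟩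
      (y ⁻¹ ∙ x ⁻¹ ⁻¹) ⁻¹  ≈⟨ ⁻¹-anti-homo-// (y ⁻¹) (x ⁻¹) ⟩
      x ⁻¹ ∙ y ⁻¹ ⁻¹       ∎

  record IsNontrivialElementaryAbelian₂ : Set (c ⊔ ℓ) where
    field
      comm       : ∀ x y → x ∙ y ≈ y ∙ x
      exponent₂  : ∀ x → x ∙ x ≈ ε
      nontrivial : ∃[ x ] ¬ x ≈ ε

  HasOrder : ℕ → Set (c ⊔ ℓ)
  HasOrder = HasCardinality setoid

record IsExtraspecial₂ (G : Group c ℓ) : Set (c ⊔ ℓ) where
  field
    finite-2-group : ∃[ k ] HasOrder G (2 ^ k)
    centre-order   : HasCardinality
      (On.setoid {B = ∃ (member (centre G))} (Group.setoid G) proj₁) 2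
    central-quotient : IsNontrivialElementaryAbelian₂
      (quotient G (centre G) (centre-normal G))

_≅_ : Group c ℓ → Group c′ ℓ′ → Set (c ⊔ ℓ ⊔ c′ ⊔ ℓ′)
G ≅ G′ = ∃[ f ] IsGroupIsomorphism (Group.rawGroup G) (Group.rawGroup G′) f

------------------------------------------------------------------------
-- Central powers

module _ (A : Group c ℓ) where
  open Group A
  open GroupProperties A
  open RawMonoidDefinitions rawMonoid using () renaming (sum to product)
  open ≈-Reasoning setoid
  private module Z = Subgroup (centre A)

  private
    product-ε : ∀ n → product {n} (λ _ → ε) ≈ ε
    product-ε zero    = refl
    product-ε (suc n) = trans (identityˡ _) (product-ε n)

    product-cong : ∀ {n} {x y : Vector Carrier n} →
                   (∀ i → x i ≈ y i) → product x ≈ product y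
    product-cong {zero}  x≈y = refl
    product-cong {suc n} x≈y = ∙-cong (x≈y zero) (product-cong (x≈y ∘ suc))

    product-∙ : ∀ {n} {x y : Vector Carrier n} → (∀ i → y i ∈ Z.member) →
                product (λ i → x i ∙ y i) ≈ product x ∙ product y
    product-∙ {zero}          yZ = sym (identityˡ ε)
    product-∙ {suc n} {x} {y} yZ = begin
      x₀ ∙ y₀ ∙ product (λ i → x (suc i) ∙ y (suc i))
                             ≈⟨ ∙-congˡ (product-∙ (yZ ∘ suc)) ⟩
      x₀ ∙ y₀ ∙ (xs ∙ ys)    ≈⟨ assoc x₀ y₀ (xs ∙ ys) ⟩
      x₀ ∙ (y₀ ∙ (xs ∙ ys))  ≈⟨ ∙-congˡ (assoc y₀ xs ys) ⟨
      x₀ ∙ (y₀ ∙ xs ∙ ys)    ≈⟨ ∙-congˡ (∙-congʳ (yZ zero xs)) ⟩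
      x₀ ∙ (xs ∙ y₀ ∙ ys)    ≈⟨ ∙-congˡ (assoc xs y₀ ys) ⟩
      x₀ ∙ (xs ∙ (y₀ ∙ ys))  ≈⟨ assoc x₀ xs (y₀ ∙ ys) ⟨
      x₀ ∙ xs ∙ (y₀ ∙ ys)    ∎
      where
      x₀ = x zero
      y₀ = y zero
      xs = product (x ∘ suc)
      ys = product (y ∘ suc)

  directPower : ℕ → Group c ℓ
  directPower m = Pointwise.group (Fin m) A

  -- The kernel of the multiplication map Z(A)ᵐ → Z(A).  Factoring it out
  -- of Aᵐ identifies the centres of the m factors with one another via
  -- the identity map of Z(A).
  centreRelations : ∀ m → Subgroup (directPower m)
  centreRelations m = record
    { member    = λ x → (∀ i → x i ∈ Z.member) × product x ≈ ε
    ; resp      = λ x≈y (xZ , xε) →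
        (λ i → Z.resp (x≈y i) (xZ i)) , trans (sym (product-cong x≈y)) xε
    ; ε-closed  = (λ _ → Z.ε-closed) , product-ε m
    ; ∙-closed  = λ {x} {y} (xZ , xε) (yZ , yε) →
        (λ i → Z.∙-closed (xZ i) (yZ i)) ,
        trans (product-∙ {x = x} yZ) (trans (∙-cong xε yε) (identityˡ ε))
    ; ⁻¹-closed = λ {x} (xZ , xε) →
        (λ i → Z.⁻¹-closed (xZ i)) ,
        (begin
          product (λ i → x i ⁻¹)
            ≈⟨ identityˡ _ ⟨
          ε ∙ product (λ i → x i ⁻¹)
            ≈⟨ ∙-congʳ xε ⟨
          product x ∙ product (λ i → x i ⁻¹)
            ≈⟨ product-∙ {x = x} (λ i → Z.⁻¹-closed (xZ i)) ⟨
          product (λ i → x i ∙ x i ⁻¹)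
            ≈⟨ product-cong (λ i → inverseʳ (x i)) ⟩
          product {m} (λ _ → ε)
            ≈⟨ product-ε m ⟩
          ε ∎)
    }

  centreRelations-normal : ∀ m → IsNormal (centreRelations m)
  centreRelations-normal m g {x} xN@(xZ , _) =
    Subgroup.resp (centreRelations m)
      (λ i → sym (trans (∙-congʳ (sym (xZ i (g i)))) (//-rightDividesʳ (g i) (x i))))
      xN

  centralPower : ℕ → Group c (c ⊔ ℓ)
  centralPower m =
    quotient (directPower m) (centreRelations m) (centreRelations-normal m)

------------------------------------------------------------------------
-- The dihedral group of order 8

-- (i , b) stands for rⁱ sᵇ, where r⁴ = s² = 1 and s r s = r⁻¹.
D₈ : Group 0ℓ 0ℓ
D₈ = record
  { Carrier = Fin 4 × Bool
  ; _≈_     = _≡_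
  ; _∙_     = _∙_
  ; ε       = 0F , false
  ; _⁻¹     = _⁻¹
  ; isGroup = record
    { isMonoid = record
      { isSemigroup = record
        { isMagma = ≡.isMagma _∙_
        ; assoc   = λ x y z → toWitness
            {a? = all? λ x → all? λ y → all? λ z → (x ∙ y) ∙ z ≟ x ∙ (y ∙ z)} _ x y z
        }
      ; identity = toWitness {a? = all? λ x → (0F , false) ∙ x ≟ x} _
                 , toWitness {a? = all? λ x → x ∙ (0F , false) ≟ x} _
      }
    ; inverse = toWitness {a? = all? λ x → x ⁻¹ ∙ x ≟ (0F , false)} _
              , toWitness {a? = all? λ x → x ∙ x ⁻¹ ≟ (0F , false)} _
    ; ⁻¹-cong = ≡.cong _⁻¹
    }
  }
  where
  infixl 7 _∙_
  infix  8 _⁻¹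
  infix  4 _≟_

  neg : Fin 4 → Fin 4
  neg 0F = 0F
  neg 1F = 3F
  neg 2F = 2F
  neg 3F = 1F

  twist : Bool → Fin 4 → Fin 4
  twist false i = i
  twist true  i = neg i

  _∙_ : Fin 4 × Bool → Fin 4 × Bool → Fin 4 × Bool
  (i , a) ∙ (j , b) = (toℕ i + toℕ (twist a j)) mod 4 , a xor b

  _⁻¹ : Fin 4 × Bool → Fin 4 × Bool
  (i , a) ⁻¹ = twist a (neg i) , a

  _≟_ : (x y : Fin 4 × Bool) → Dec (x ≡ y)
  _≟_ = ≡-dec Fin._≟_ Bool._≟_

  all? : ∀ {q} {P : Pred (Fin 4 × Bool) q} → Decidable P → Dec (∀ x → P x)
  all? P? = map′
    (λ { (f , g) (i , false) → f i ; (f , g) (i , true) → g i })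
    (λ h → (λ i → h (i , false)) , (λ i → h (i , true)))
    (Fin.all? (λ i → P? (i , false)) ×-dec Fin.all? (λ i → P? (i , true)))

-- The central product D₈ ∘ ⋯ ∘ D₈ of m copies of D₈.
G⟨_,1⟩ : ℕ → Group 0ℓ 0ℓ
G⟨ m ,1⟩ = centralPower D₈ m

-- Write the squaring map and the commutator of G on G/Z as a quadratic form Q
-- with polar form B over 𝔽₂, and let z generate Z.  If H is a perfect code and
-- Z ≤ H, every connection element is an involution; conversely, choosing
-- involutions (or inverse pairs s, sz) as coset representatives shows that H is
-- a perfect code as soon as z ∈ H implies that every coset gH contains an
-- element of square 1.  A coset violates this exactly when Q(g) = 1 and
-- Q(h) = B(g, h) on H, which forces H to be abelian; and if z ∉ H then H is
-- abelian and, being nontrivial, not normal.  For abelian H containing Z, Q is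
-- linear on H, hence of the form B(g, -); if all cosets contain involutions
-- then Q vanishes on g + H^⊥, so H = H^⊥ is Lagrangian and (H ∩ g^⊥)⟨g⟩ is a
-- Lagrangian on which Q vanishes.  Such a singular Lagrangian yields a
-- hyperbolic basis, that is, an isomorphism with D₈ ∘ ⋯ ∘ D₈.  Conversely a
-- singular Lagrangian can be moved by exchange steps so as to contain H ∩ g^⊥
-- for any Lagrangian H, which excludes a violating g.
module Submission where

open import Defs
open import Algebra.Bundles using (Group)
import Algebra.Definitions.RawMonoid as RawMonoidDefinitions
open import Algebra.Morphism.Structures using (IsGroupIsomorphism)
import Algebra.Properties.Group as GroupProperties
import Algebra.Properties.Monoid.Mult as Mult
open import Data.Bool.Base using (Bool; true; false; not; _xor_; _∧_)
import Data.Bool.Properties as Bool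
open import Data.Empty using (⊥-elim)
open import Data.Fin.Base as Fin using (Fin; zero; suc; toℕ)
open import Data.Fin.Patterns using (0F; 1F; 2F; 3F)
import Data.Fin.Properties as Fin
open import Data.List.Base as List using (List; []; _∷_)
open import Data.List.Membership.Propositional.Properties using (∈-tabulate⁺; ∈-filter⁺)
open import Data.List.Relation.Unary.All as All using (All; []; _∷_)
open import Data.List.Relation.Unary.All.Properties using (all-filter)
open import Data.Nat.Base using (ℕ; zero; suc; _≤_; z≤n; s≤s; _+_; _*_; _^_)
open import Data.Nat.DivMod using (_mod_; _%_; m%n<n)
import Data.Nat.Properties as ℕ
open import Data.Product using (∃!)
open import Data.Product.Base using (∃; Σ-syntax; ∃-syntax; _×_; _,_; proj₁; proj₂)
open import Data.Product.Properties using (≡-dec)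
open import Data.Sum.Base using (_⊎_; inj₁; inj₂)
open import Data.Vec.Functional as Vector using (Vector)
open import Function.Base using (_∘_)
open import Function.Bundles using (_⇔_; mk⇔; Inverse)
open import Level using (Level; _⊔_; 0ℓ)
open import Relation.Binary.Definitions using (_Respects_; tri<; tri≈; tri>)
open import Relation.Binary.PropositionalEquality as ≡ using (_≡_; _≢_; cong; cong₂)
import Relation.Binary.Reasoning.Setoid as ≈-Reasoning
open import Relation.Nullary using (¬_; Dec; yes; no; contradiction)
open import Relation.Nullary.Decidable
  using (map′; _×-dec_; _⊎-dec_; _→-dec_; decidable-stable; toWitness)
open import Relation.Unary using (Pred; _∈_; _∉_; Decidable)

open Subgroup using (member)

private
  variable
    p : Level

-- The argument has to do without bases and dimensions of G/Z. Subspaces are subgroups of G that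
-- contain Z, existence questions are settled by searching the finite group, and linear algebra runs
-- by induction over lists of elements. Its engine is a fact about 𝔽₂: a functional that vanishes on
-- the kernel of another one is either 0 or equal to it. This yields both double orthogonal
-- complements and the complement of a hyperplane of a Lagrangian. Singular Lagrangians, rather than
-- isomorphisms, mediate between perfect codes and D₈ ∘ ⋯ ∘ D₈, because exchange steps act on them
-- without coordinates. Coordinates appear only in the hyperbolic basis, whose rank n is not known
-- beforehand: it is the rank at which extension stops, and comparing |G| = 2 · 4ⁿ with 2^(2m+1)
-- gives n = m. The hypothesis m ≥ 1 enters there, since an empty central product is trivial and has
-- no room for z. The connection set must be a predicate that respects equality, so coset
-- representatives are chosen by least index.

-- Bits and least elements

not-xor≡true⇒≡ : ∀ a b → not a xor b ≡ true → a ≡ b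
not-xor≡true⇒≡ false b eq = ≡.sym (Bool.not-injective eq)
not-xor≡true⇒≡ true  b eq = ≡.sym eq

xor-fixed⇒false : ∀ a {b} → a xor b ≡ a → b ≡ false
xor-fixed⇒false false eq = eq
xor-fixed⇒false true  eq = Bool.not-injective eq

opposite-≢ : (i : Fin 2) → Fin.opposite i ≢ i
opposite-≢ 0F ()
opposite-≢ 1F ()

≡⊎≡opposite : (i j : Fin 2) → j ≡ i ⊎ j ≡ Fin.opposite i
≡⊎≡opposite 0F 0F = inj₁ ≡.refl
≡⊎≡opposite 0F 1F = inj₂ ≡.refl
≡⊎≡opposite 1F 0F = inj₂ ≡.refl
≡⊎≡opposite 1F 1F = inj₁ ≡.refl

least : ∀ {n} {P : Pred (Fin n) p} → Decidable P → ∃ P →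
        ∃[ i ] P i × (∀ {j} → P j → i Fin.≤ j)
least P? (zero , Pi) = zero , Pi , λ _ → z≤n
least {P = P} P? (suc i , Pi) with P? zero
... | yes P₀ = zero , P₀ , λ _ → z≤n
... | no ¬P₀ with least (P? ∘ suc) (i , Pi)
...   | j , Pj , j≤ = suc j , Pj , λ
  { {zero}  P₀ → contradiction P₀ ¬P₀
  ; {suc k} Pk → s≤s (j≤ Pk)
  }

-- Products over finite families

module Products {c ℓ : Level} (A : Group c ℓ) where
  open Group A
  open RawMonoidDefinitions rawMonoid public using () renaming (sum to product)
  open ≈-Reasoning setoid

  commute-∙ : ∀ {x y u} → u ∙ x ≈ x ∙ u → u ∙ y ≈ y ∙ u → u ∙ (x ∙ y) ≈ x ∙ y ∙ u
  commute-∙ {x} {y} {u} ux uy = begin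
    u ∙ (x ∙ y)  ≈⟨ assoc u x y ⟨
    u ∙ x ∙ y    ≈⟨ ∙-congʳ ux ⟩
    x ∙ u ∙ y    ≈⟨ assoc x u y ⟩
    x ∙ (u ∙ y)  ≈⟨ ∙-congˡ uy ⟩
    x ∙ (y ∙ u)  ≈⟨ assoc x y u ⟨
    x ∙ y ∙ u    ∎

  commute-product : ∀ {n} {x : Vector Carrier n} {u} → (∀ i → u ∙ x i ≈ x i ∙ u) →
                    u ∙ product x ≈ product x ∙ u
  commute-product {zero}  ux = trans (identityʳ _) (sym (identityˡ _))
  commute-product {suc n} ux = commute-∙ (ux zero) (commute-product (ux ∘ suc))

  product-cong : ∀ {n} {x y : Vector Carrier n} → (∀ i → x i ≈ y i) → product x ≈ product y
  product-cong {zero}  x≈y = refl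
  product-cong {suc n} x≈y = ∙-cong (x≈y zero) (product-cong (x≈y ∘ suc))

  -- Factors with equal index are never interchanged, so each pair `x i`, `y i` may fail to commute.
  -- This is what makes a product of non-abelian, mutually commuting factors multiplicative.
  product-∙ : ∀ {n} {x y : Vector Carrier n} →
              (∀ i j → i ≢ j → y i ∙ x j ≈ x j ∙ y i) →
              product (λ i → x i ∙ y i) ≈ product x ∙ product y
  product-∙ {zero}          yx = sym (identityˡ ε)
  product-∙ {suc n} {x} {y} yx = begin
    x₀ ∙ y₀ ∙ product (λ i → x (suc i) ∙ y (suc i))
                           ≈⟨ ∙-congˡ (product-∙ (λ i j i≢j →
                                yx (suc i) (suc j) (i≢j ∘ Fin.suc-injective))) ⟩
    x₀ ∙ y₀ ∙ (xs ∙ ys)    ≈⟨ assoc x₀ y₀ (xs ∙ ys) ⟩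
    x₀ ∙ (y₀ ∙ (xs ∙ ys))  ≈⟨ ∙-congˡ (assoc y₀ xs ys) ⟨
    x₀ ∙ (y₀ ∙ xs ∙ ys)    ≈⟨ ∙-congˡ (∙-congʳ (commute-product (λ i → yx zero (suc i) λ ()))) ⟩
    x₀ ∙ (xs ∙ y₀ ∙ ys)    ≈⟨ ∙-congˡ (assoc xs y₀ ys) ⟩
    x₀ ∙ (xs ∙ (y₀ ∙ ys))  ≈⟨ assoc x₀ xs (y₀ ∙ ys) ⟨
    x₀ ∙ xs ∙ (y₀ ∙ ys)    ∎
    where
    x₀ = x zero
    y₀ = y zero
    xs = product (x ∘ suc)
    ys = product (y ∘ suc)

  product-ε : ∀ {n} {x : Vector Carrier n} → (∀ i → x i ≈ ε) → product x ≈ ε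
  product-ε {zero}  x≈ε = refl
  product-ε {suc n} x≈ε = trans (∙-cong (x≈ε zero) (product-ε (x≈ε ∘ suc))) (identityˡ ε)

  product-single : ∀ {n} {x : Vector Carrier n} i → (∀ j → j ≢ i → x j ≈ ε) → product x ≈ x i
  product-single zero    x≈ε =
    trans (∙-congˡ (product-ε (λ j → x≈ε (suc j) λ ()))) (identityʳ _)
  product-single (suc i) x≈ε = trans (∙-cong (x≈ε zero λ ())
    (product-single i (λ j j≢i → x≈ε (suc j) (j≢i ∘ Fin.suc-injective)))) (identityˡ _)

-- The dihedral group of order 8

module D = Group D₈

all-D₈? : {P : Pred D.Carrier p} → Decidable P → Dec (∀ u → P u)
all-D₈? P? = map′
  (λ { (f , g) (i , false) → f i ; (f , g) (i , true) → g i })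
  (λ h → (λ i → h (i , false)) , (λ i → h (i , true)))
  (Fin.all? (λ i → P? (i , false)) ×-dec Fin.all? (λ i → P? (i , true)))

_≟-D₈_ : (u v : D.Carrier) → Dec (u ≡ v)
_≟-D₈_ = ≡-dec Fin._≟_ Bool._≟_

reflection : D.Carrier
reflection = 0F , true

-- The subgroup {1, r², s, r²s}, presented as the centralizer of the reflection: commuting with that
-- single element then already forces membership.
Klein : Pred D.Carrier 0ℓ
Klein u = u D.∙ reflection ≡ reflection D.∙ u

Klein? : Decidable Klein
Klein? u = (u D.∙ reflection) ≟-D₈ (reflection D.∙ u)

Klein-∙ : ∀ u v → Klein u → Klein v → Klein (u D.∙ v)
Klein-∙ = toWitness
  {a? = all-D₈? λ u → all-D₈? λ v → Klein? u →-dec Klein? v →-dec Klein? (u D.∙ v)} _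

Klein-⁻¹ : ∀ u → Klein u → Klein (u D.⁻¹)
Klein-⁻¹ = toWitness {a? = all-D₈? λ u → Klein? u →-dec Klein? (u D.⁻¹)} _

Klein-square : ∀ u → Klein u → u D.∙ u ≡ D.ε
Klein-square = toWitness {a? = all-D₈? λ u → Klein? u →-dec (u D.∙ u) ≟-D₈ D.ε} _

κ : Bool → D.Carrier
κ false = 0F , false
κ true  = 2F , false

κ-injective : ∀ {a b} → κ a ≡ κ b → a ≡ b
κ-injective {false} {false} _ = ≡.refl
κ-injective {true}  {true}  _ = ≡.refl

κ-xor : ∀ a b → κ a D.∙ κ b ≡ κ (a xor b)
κ-xor false false = ≡.refl
κ-xor false true  = ≡.refl
κ-xor true  false = ≡.refl
κ-xor true  true  = ≡.refl

κ-central : ∀ b → κ b ∈ member (centre D₈)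
κ-central false = toWitness {a? = all-D₈? λ u → (κ false D.∙ u) ≟-D₈ (u D.∙ κ false)} _
κ-central true  = toWitness {a? = all-D₈? λ u → (κ true D.∙ u) ≟-D₈ (u D.∙ κ true)} _

-- Together with the reflection bit, the parity of the rotation gives the two coordinates on D₈ /
-- Z(D₈).
odd : Fin 4 → Bool
odd 0F = false
odd 1F = true
odd 2F = false
odd 3F = true

even-rotation : ∀ u → odd (proj₁ u) ≡ false → proj₂ u ≡ false → ∃[ b ] u ≡ κ b
even-rotation (0F , false) _ _ = false , ≡.refl
even-rotation (2F , false) _ _ = true , ≡.refl
even-rotation (3F , false) ()

κ-surjective : ∀ u → u ∈ member (centre D₈) → ∃[ b ] u ≡ κ b
κ-surjective (0F , false) _ = false , ≡.refl
κ-surjective (2F , false) _ = true , ≡.refl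
κ-surjective (1F , false) u∈Z = contradiction (u∈Z reflection) λ ()
κ-surjective (3F , false) u∈Z = contradiction (u∈Z reflection) λ ()
κ-surjective (0F , true)  u∈Z = contradiction (u∈Z (1F , false)) λ ()
κ-surjective (1F , true)  u∈Z = contradiction (u∈Z (1F , false)) λ ()
κ-surjective (2F , true)  u∈Z = contradiction (u∈Z (1F , false)) λ ()
κ-surjective (3F , true)  u∈Z = contradiction (u∈Z (1F , false)) λ ()

rotation : Bool → Fin 4
rotation false = 0F
rotation true  = 1F

odd-rotation : ∀ b → odd (rotation b) ≡ b
odd-rotation false = ≡.refl
odd-rotation true  = ≡.refl

-- A transversal of the centre, numbered in order to count elements: each dihedral factor
-- contributes a factor 4 to the order.
quarter : Fin 4 → D.Carrier
quarter 0F = 0F , false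
quarter 1F = 0F , true
quarter 2F = 1F , false
quarter 3F = 1F , true

quarter⁻¹ : Bool → Bool → Fin 4
quarter⁻¹ false false = 0F
quarter⁻¹ false true  = 1F
quarter⁻¹ true  false = 2F
quarter⁻¹ true  true  = 3F

quarter-quarter⁻¹ : ∀ a b → quarter (quarter⁻¹ a b) ≡ (rotation a , b)
quarter-quarter⁻¹ false false = ≡.refl
quarter-quarter⁻¹ false true  = ≡.refl
quarter-quarter⁻¹ true  false = ≡.refl
quarter-quarter⁻¹ true  true  = ≡.refl

quarter⁻¹-quarter : ∀ k → quarter⁻¹ (odd (proj₁ (quarter k))) (proj₂ (quarter k)) ≡ k
quarter⁻¹-quarter 0F = ≡.refl
quarter⁻¹-quarter 1F = ≡.refl
quarter⁻¹-quarter 2F = ≡.refl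
quarter⁻¹-quarter 3F = ≡.refl

-- Counting by one bit and n base-four digits

funToFin-cong : ∀ {m n} {u v : Fin m → Fin n} → (∀ i → u i ≡ v i) →
                Fin.funToFin u ≡ Fin.funToFin v
funToFin-cong {zero}  u≡v = ≡.refl
funToFin-cong {suc m} u≡v = cong₂ Fin.combine (u≡v zero) (funToFin-cong (u≡v ∘ suc))

module _ {n : ℕ} where

  encode : Bool → (Fin n → Fin 4) → Fin (2 * 4 ^ n)
  encode b u = Fin.combine (Inverse.from Fin.2↔Bool b) (Fin.funToFin u)

  encode-cong : ∀ {a b u v} → a ≡ b → (∀ i → u i ≡ v i) → encode a u ≡ encode b v
  encode-cong a≡b u≡v = cong₂ Fin.combine (cong (Inverse.from Fin.2↔Bool) a≡b) (funToFin-cong u≡v)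

  encode-injective : ∀ {a b u v} → encode a u ≡ encode b v → a ≡ b × (∀ i → u i ≡ v i)
  encode-injective {a} {b} {u} {v} e with Fin.combine-injective _ _ _ _ e
  ... | e₁ , e₂ =
    ≡.trans (≡.sym (Inverse.strictlyInverseˡ Fin.2↔Bool a))
      (≡.trans (cong (Inverse.to Fin.2↔Bool) e₁) (Inverse.strictlyInverseˡ Fin.2↔Bool b)) ,
    λ i → ≡.trans (≡.sym (Fin.finToFun-funToFin u i))
      (≡.trans (cong (λ k → Fin.finToFun k i) e₂) (Fin.finToFun-funToFin v i))

  encode-surjective : ∀ k → ∃[ b ] ∃[ u ] encode b u ≡ k
  encode-surjective k with Fin.combine-surjective {2} {4 ^ n} k
  ... | i , j , e = Inverse.to Fin.2↔Bool i , Fin.finToFun j ,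
    ≡.trans (cong₂ Fin.combine (Inverse.strictlyInverseʳ Fin.2↔Bool i)
      (Fin.funToFin-finToFin {n} {4} j)) e

2^-injective : ∀ {m n} → 2 ^ m ≡ 2 ^ n → m ≡ n
2^-injective {m} {n} e with ℕ.<-cmp m n
... | tri< m<n _ _ = contradiction e (ℕ.<⇒≢ (ℕ.^-monoʳ-< 2 (s≤s (s≤s z≤n)) m<n))
... | tri≈ _ m≡n _ = m≡n
... | tri> _ _ n<m = contradiction (≡.sym e) (ℕ.<⇒≢ (ℕ.^-monoʳ-< 2 (s≤s (s≤s z≤n)) n<m))

exponent-unique : ∀ m n → 2 ^ (2 * m + 1) ≡ 2 * 4 ^ n → m ≡ n
exponent-unique m n e = ℕ.*-cancelˡ-≡ m n 2 (ℕ.suc-injective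
  (≡.trans (ℕ.+-comm 1 (2 * m)) (2^-injective (≡.trans e (cong (2 *_) (ℕ.^-*-assoc 2 2 n))))))

-- Equality in the central power of D₈

module CentralPower (m : ℕ) where
  open Group G⟨ m ,1⟩ public
  open Products D₈ public
  open GroupProperties D₈ using (x≈y⇒x∙y⁻¹≈ε; x∙y⁻¹≈ε⇒x≈y; //-rightDividesˡ)

  pointwise : ∀ {u v : Carrier} → (∀ i → u i ≡ v i) → u ≈ v
  pointwise u≡v = Subgroup.resp (centreRelations D₈ m)
    (λ i → ≡.sym (x≈y⇒x∙y⁻¹≈ε (u≡v i))) (Subgroup.ε-closed (centreRelations D₈ m))

  -- Equal elements of the central power differ in each coordinate by a central factor, and the
  -- Klein subgroup contains the centre.
  Klein-resp : ∀ {u v : Carrier} → u ≈ v → ∀ i → Klein (u i) → Klein (v i)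
  Klein-resp {u} {v} u≈v i = ≡.subst Klein
    (//-rightDividesˡ (u i) (v i)) ∘
    Klein-∙ (v i D.∙ u i D.⁻¹) (u i) (proj₁ (sym {u} {v} u≈v) i reflection)

  -- The quotients of the coordinates multiply to 1. When all but one of them are trivial, so is the
  -- last.
  equal-at : ∀ {u v : Carrier} i → (∀ j → j ≢ i → u j ≡ v j) → u ≈ v → u i ≡ v i
  equal-at {u} {v} i u≡v (_ , uv⁻¹≡ε) = x∙y⁻¹≈ε⇒x≈y (u i) (v i)
    (≡.trans (≡.sym (product-single {x = λ j → u j D.∙ v j D.⁻¹} i
      (λ j j≢i → x≈y⇒x∙y⁻¹≈ε (u≡v j j≢i)))) uv⁻¹≡ε)

  single : Fin m → D.Carrier → Carrier
  single i t j with j Fin.≟ i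
  ... | yes _ = t
  ... | no  _ = D.ε

  single-≡ : ∀ i t → single i t i ≡ t
  single-≡ i t with i Fin.≟ i
  ... | yes _   = ≡.refl
  ... | no  i≢i = contradiction ≡.refl i≢i

  single-≢ : ∀ {i j} t → j ≢ i → single i t j ≡ D.ε
  single-≢ {i} {j} t j≢i with j Fin.≟ i
  ... | yes j≡i = contradiction j≡i j≢i
  ... | no  _   = ≡.refl

  single-Klein : ∀ i {t} → Klein t → ∀ j → Klein (single i t j)
  single-Klein i Kt j with j Fin.≟ i
  ... | yes _ = Kt
  ... | no  _ = ≡.refl

  -- Away from i the two products agree exactly, so `equal-at` turns commutation modulo the central
  -- relations into commutation in coordinate i.
  centralizes-reflection : ∀ {u : Carrier} i → u ∙ single i reflection ≈ single i reflection ∙ u →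
                           Klein (u i)
  centralizes-reflection {u} i comm =
    ≡.subst (λ t → u i D.∙ t ≡ t D.∙ u i) (single-≡ i reflection)
      (equal-at {u ∙ single i reflection} {single i reflection ∙ u} i
        (λ j j≢i → ≡.subst (λ t → u j D.∙ t ≡ t D.∙ u j) (≡.sym (single-≢ reflection j≢i))
          (≡.trans (D.identityʳ (u j)) (≡.sym (D.identityˡ (u j)))))
        comm)

-- Search and canonical choice in a finite group

module FiniteGroup {c ℓ : Level} (G : Group c ℓ) {N : ℕ} (order : HasOrder G N) where
  open Group G

  index : Carrier → Fin N
  index = Inverse.to order

  elem : Fin N → Carrier
  elem = Inverse.from order

  elem-index : ∀ x → elem (index x) ≈ x
  elem-index = Inverse.strictlyInverseʳ order

  index-injective : ∀ {x y} → index x ≡ index y → x ≈ y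
  index-injective {x} {y} eq =
    trans (sym (elem-index x)) (trans (Inverse.from-cong order eq) (elem-index y))

  any-element? : {P : Pred Carrier p} → P Respects _≈_ → Decidable P → Dec (∃ P)
  any-element? resp P? = map′
    (λ (i , Pi) → elem i , Pi)
    (λ (x , Px) → index x , resp (sym (elem-index x)) Px)
    (Fin.any? (P? ∘ elem))

  -- Injections in both directions suffice. The one out of `Fin N` encodes a chosen preimage under
  -- `decode`, from which the element can be recovered.
  parametrized⇒order : ∀ {n} (decode : Bool → (Fin n → Fin 4) → Carrier) →
    (∀ b {u v} → (∀ i → u i ≡ v i) → decode b u ≈ decode b v) →
    (∀ {a b u v} → decode a u ≈ decode b v → a ≡ b × (∀ i → u i ≡ v i)) →
    (∀ x → ∃[ b ] ∃[ u ] decode b u ≈ x) → N ≡ 2 * 4 ^ n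
  parametrized⇒order {n} decode decode-cong decode-injective decode-surjective =
    Fin.cantor-schröder-bernstein {f = to} {g = from} to-injective from-injective
    where
    bit : Fin (2 * 4 ^ n) → Bool
    bit k = proj₁ (encode-surjective {n} k)

    digits : Fin (2 * 4 ^ n) → Fin n → Fin 4
    digits k = proj₁ (proj₂ (encode-surjective {n} k))

    encode-digits : ∀ k → encode (bit k) (digits k) ≡ k
    encode-digits k = proj₂ (proj₂ (encode-surjective {n} k))

    from : Fin (2 * 4 ^ n) → Fin N
    from k = index (decode (bit k) (digits k))

    from-injective : ∀ {k l} → from k ≡ from l → k ≡ l
    from-injective {k} {l} e
      with decode-injective {bit k} {bit l} {digits k} {digits l} (index-injective e)
    ... | same-bit , same-digits = ≡.trans (≡.sym (encode-digits k))
      (≡.trans (encode-cong same-bit same-digits) (encode-digits l))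

    to : Fin N → Fin (2 * 4 ^ n)
    to i with decode-surjective (elem i)
    ... | b , u , _ = encode b u

    to-injective : ∀ {i j} → to i ≡ to j → i ≡ j
    to-injective {i} {j} e with decode-surjective (elem i) | decode-surjective (elem j)
    ... | a , u , p | b , v , q with encode-injective {n} {a} {b} {u} {v} e
    ...   | ≡.refl , u≡v = ≡.trans (≡.sym (Inverse.strictlyInverseˡ order i))
      (≡.trans (Inverse.to-cong order (trans (sym p) (trans (decode-cong a u≡v) q)))
        (Inverse.strictlyInverseˡ order j))

  IsFirst : Pred Carrier p → Pred Carrier (c ⊔ p)
  IsFirst P x = P x × (∀ {y} → P y → index x Fin.≤ index y)

  first : {P : Pred Carrier p} → P Respects _≈_ → Decidable P → ∃ P → ∃ (IsFirst P)
  first {P = P} resp P? (x , Px) with least (P? ∘ elem) (index x , resp (sym (elem-index x)) Px)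
  ... | i , Pi , i≤ = elem i , Pi , λ {y} Py → ≡.subst (Fin._≤ index y)
    (≡.sym (Inverse.strictlyInverseˡ order i)) (i≤ (resp (sym (elem-index y)) Py))

  first-unique : {P : Pred Carrier p} → ∀ {x y} → IsFirst P x → IsFirst P y → x ≈ y
  first-unique (Px , x≤) (Py , y≤) = index-injective (Fin.≤-antisym (x≤ Py) (y≤ Px))

  -- The least element depends only on the set. A coset described through two of its elements
  -- therefore receives the same representative.
  first-transport : {P P′ : Pred Carrier p} → P′ Respects _≈_ →
                    (∀ {y} → P y → P′ y) → (∀ {y} → P′ y → P y) →
                    ∀ {x x′} → x ≈ x′ → IsFirst P x → IsFirst P′ x′
  first-transport resp to from x≈x′ (Px , x≤) = resp x≈x′ (to Px) ,
    λ {y} P′y → ≡.subst (Fin._≤ index y) (Inverse.to-cong order x≈x′) (x≤ (from P′y))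

  module _ (H : Subgroup G) (H? : Decidable (member H)) where

    elements : List Carrier
    elements = List.filter H? (List.tabulate elem)

    elements-sound : All (member H) elements
    elements-sound = all-filter H? (List.tabulate elem)

    elements-complete : {P : Pred Carrier p} → P Respects _≈_ →
                        All P elements → ∀ {x} → x ∈ member H → P x
    elements-complete resp allP {x} x∈H = resp (elem-index x)
      (All.lookup allP (∈-filter⁺ H? (∈-tabulate⁺ (index x))
        (Subgroup.resp H (sym (elem-index x)) x∈H)))

-- The forms B and Q on G/Z

module Extraspecial {c ℓ : Level} (G : Group c ℓ) (extraspecial : IsExtraspecial₂ G)
                    {N : ℕ} (order : HasOrder G N) where
  open Group G
  open GroupProperties G
  open IsExtraspecial₂ extraspecial
  open IsNontrivialElementaryAbelian₂ central-quotient
  open FiniteGroup G order public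
  open ≈-Reasoning setoid hiding (stop; step-≡-⟩; step-≡-⟨)

  private
    module Z = Subgroup (centre G)
    module Z₂ = Inverse centre-order
    ε-index : Fin 2
    ε-index = Z₂.to (ε , Z.ε-closed)

  -- The centre has exactly two indices; z sits at the one that `ε` does not occupy.
  z : Carrier
  z = proj₁ (Z₂.from (Fin.opposite ε-index))

  ζ : Bool → Carrier
  ζ false = ε
  ζ true  = z

  ζ-central : ∀ b x → ζ b ∙ x ≈ x ∙ ζ b
  ζ-central false = Z.ε-closed
  ζ-central true  = proj₂ (Z₂.from (Fin.opposite ε-index))

  z≉ε : ¬ z ≈ ε
  z≉ε z≈ε = opposite-≢ ε-index
    (≡.trans (≡.sym (Z₂.strictlyInverseˡ _)) (Z₂.to-cong z≈ε))

  ζ-surjective : ∀ {x} → x ∈ member (centre G) → ∃[ b ] x ≈ ζ b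
  ζ-surjective {x} x∈Z with ≡⊎≡opposite ε-index (Z₂.to (x , x∈Z))
  ... | inj₁ eq = false , trans (sym (Z₂.strictlyInverseʳ (x , x∈Z)))
                            (trans (Z₂.from-cong eq) (Z₂.strictlyInverseʳ _))
  ... | inj₂ eq = true , trans (sym (Z₂.strictlyInverseʳ (x , x∈Z))) (Z₂.from-cong eq)

  ζ-injective : ∀ {a b} → ζ a ≈ ζ b → a ≡ b
  ζ-injective {false} {false} _ = ≡.refl
  ζ-injective {false} {true}  e = contradiction (sym e) z≉ε
  ζ-injective {true}  {false} e = contradiction e z≉ε
  ζ-injective {true}  {true}  _ = ≡.refl

  z∙z≈ε : z ∙ z ≈ ε
  z∙z≈ε with ζ-surjective (Z.∙-closed (ζ-central true) (ζ-central true))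
  ... | false , e = e
  ... | true  , e = contradiction (∙-cancelˡ z z ε (trans e (sym (identityʳ z)))) z≉ε

  ζ-xor : ∀ a b → ζ (a xor b) ≈ ζ a ∙ ζ b
  ζ-xor false b     = sym (identityˡ (ζ b))
  ζ-xor true  false = sym (identityʳ z)
  ζ-xor true  true  = sym z∙z≈ε

  ζ-xor-∙ : ∀ a b x → ζ a ∙ (ζ b ∙ x) ≈ ζ (a xor b) ∙ x
  ζ-xor-∙ a b x = trans (sym (assoc (ζ a) (ζ b) x)) (∙-congʳ (sym (ζ-xor a b)))

  ζ-involutive : ∀ b x → ζ b ∙ (ζ b ∙ x) ≈ x
  ζ-involutive b x = begin
    ζ b ∙ (ζ b ∙ x)  ≈⟨ ζ-xor-∙ b b x ⟩
    ζ (b xor b) ∙ x  ≈⟨ ∙-congʳ (reflexive (cong ζ (Bool.xor-same b))) ⟩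
    ε ∙ x            ≈⟨ identityˡ x ⟩
    x                ∎

  ζ-shift : ∀ b x y → x ∙ (ζ b ∙ y) ≈ ζ b ∙ (x ∙ y)
  ζ-shift b x y = begin
    x ∙ (ζ b ∙ y)  ≈⟨ assoc x (ζ b) y ⟨
    x ∙ ζ b ∙ y    ≈⟨ ∙-congʳ (ζ-central b x) ⟨
    ζ b ∙ x ∙ y    ≈⟨ assoc (ζ b) x y ⟩
    ζ b ∙ (x ∙ y)  ∎

  -- The symplectic form B(x, y) = [x, y] and the quadratic form Q(x) = x²
  -- on G/Z, with Z identified with 𝔽₂ through ζ.
  abstract
    B : Carrier → Carrier → Bool
    B x y = proj₁ (ζ-surjective (comm x y))

    Q : Carrier → Bool
    Q x = proj₁ (ζ-surjective (exponent₂ x))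

    B-spec : ∀ x y → x ∙ y ≈ ζ (B x y) ∙ (y ∙ x)
    B-spec x y = trans (sym (//-rightDividesˡ (y ∙ x) (x ∙ y)))
                       (∙-congʳ (proj₂ (ζ-surjective (comm x y))))

    Q-spec : ∀ x → x ∙ x ≈ ζ (Q x)
    Q-spec x = begin
      x ∙ x          ≈⟨ identityʳ (x ∙ x) ⟨
      x ∙ x ∙ ε      ≈⟨ ∙-congˡ ε⁻¹≈ε ⟨
      x ∙ x ∙ ε ⁻¹   ≈⟨ proj₂ (ζ-surjective (exponent₂ x)) ⟩
      ζ (Q x)        ∎

  B-unique : ∀ {x y b} → x ∙ y ≈ ζ b ∙ (y ∙ x) → B x y ≡ b
  B-unique {x} {y} e = ζ-injective (∙-cancelʳ (y ∙ x) _ _ (trans (sym (B-spec x y)) e))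

  Q-unique : ∀ {x b} → x ∙ x ≈ ζ b → Q x ≡ b
  Q-unique {x} e = ζ-injective (trans (sym (Q-spec x)) e)

  B-cong : ∀ {x y u v} → x ≈ y → u ≈ v → B x u ≡ B y v
  B-cong {x} {y} {u} {v} x≈y u≈v = B-unique (begin
    x ∙ u                ≈⟨ ∙-cong x≈y u≈v ⟩
    y ∙ v                ≈⟨ B-spec y v ⟩
    ζ (B y v) ∙ (v ∙ y)  ≈⟨ ∙-congˡ (∙-cong u≈v x≈y) ⟨
    ζ (B y v) ∙ (u ∙ x)  ∎)

  Q-cong : ∀ {x y} → x ≈ y → Q x ≡ Q y
  Q-cong {x} {y} x≈y = Q-unique (trans (∙-cong x≈y x≈y) (Q-spec y))

  commute⇒B : ∀ {x y} → x ∙ y ≈ y ∙ x → B x y ≡ false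
  commute⇒B e = B-unique (trans e (sym (identityˡ _)))

  B⇒commute : ∀ {x y} → B x y ≡ false → x ∙ y ≈ y ∙ x
  B⇒commute {x} {y} e = begin
    x ∙ y                ≈⟨ B-spec x y ⟩
    ζ (B x y) ∙ (y ∙ x)  ≈⟨ ∙-congʳ (reflexive (cong ζ e)) ⟩
    ε ∙ (y ∙ x)          ≈⟨ identityˡ (y ∙ x) ⟩
    y ∙ x                ∎

  B-self : ∀ x → B x x ≡ false
  B-self x = commute⇒B refl

  B-sym : ∀ x y → B x y ≡ B y x
  B-sym x y = B-unique (begin
    x ∙ y                              ≈⟨ ζ-involutive (B y x) (x ∙ y) ⟨
    ζ (B y x) ∙ (ζ (B y x) ∙ (x ∙ y))  ≈⟨ ∙-congˡ (B-spec y x) ⟨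
    ζ (B y x) ∙ (y ∙ x)                ∎)

  B-∙ʳ : ∀ x y w → B x (y ∙ w) ≡ B x y xor B x w
  B-∙ʳ x y w = B-unique (begin
    x ∙ (y ∙ w)                              ≈⟨ assoc x y w ⟨
    x ∙ y ∙ w                                ≈⟨ ∙-congʳ (B-spec x y) ⟩
    ζ (B x y) ∙ (y ∙ x) ∙ w                  ≈⟨ assoc _ _ _ ⟩
    ζ (B x y) ∙ (y ∙ x ∙ w)                  ≈⟨ ∙-congˡ (assoc y x w) ⟩
    ζ (B x y) ∙ (y ∙ (x ∙ w))                ≈⟨ ∙-congˡ (∙-congˡ (B-spec x w)) ⟩
    ζ (B x y) ∙ (y ∙ (ζ (B x w) ∙ (w ∙ x)))  ≈⟨ ∙-congˡ (ζ-shift (B x w) y (w ∙ x)) ⟩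
    ζ (B x y) ∙ (ζ (B x w) ∙ (y ∙ (w ∙ x)))  ≈⟨ ζ-xor-∙ (B x y) (B x w) _ ⟩
    ζ (B x y xor B x w) ∙ (y ∙ (w ∙ x))      ≈⟨ ∙-congˡ (assoc y w x) ⟨
    ζ (B x y xor B x w) ∙ (y ∙ w ∙ x)        ∎)

  B-∙ˡ : ∀ x y w → B (x ∙ y) w ≡ B x w xor B y w
  B-∙ˡ x y w = ≡.trans (B-sym (x ∙ y) w)
    (≡.trans (B-∙ʳ w x y) (cong₂ _xor_ (B-sym w x) (B-sym w y)))

  B-ζˡ : ∀ b x → B (ζ b) x ≡ false
  B-ζˡ b x = commute⇒B (ζ-central b x)

  Q-ζ : ∀ b → Q (ζ b) ≡ false
  Q-ζ b = Q-unique (trans (sym (ζ-xor b b)) (reflexive (cong ζ (Bool.xor-same b))))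

  Q-∙ : ∀ x y → Q (x ∙ y) ≡ (Q x xor Q y) xor B x y
  Q-∙ x y = ≡.trans (Q-unique (begin
    x ∙ y ∙ (x ∙ y)                          ≈⟨ assoc x y (x ∙ y) ⟩
    x ∙ (y ∙ (x ∙ y))                        ≈⟨ ∙-congˡ (assoc y x y) ⟨
    x ∙ (y ∙ x ∙ y)                          ≈⟨ ∙-congˡ (∙-congʳ (B-spec y x)) ⟩
    x ∙ (ζ (B y x) ∙ (x ∙ y) ∙ y)            ≈⟨ ∙-congˡ (assoc _ _ _) ⟩
    x ∙ (ζ (B y x) ∙ (x ∙ y ∙ y))            ≈⟨ ζ-shift (B y x) x _ ⟩
    ζ (B y x) ∙ (x ∙ (x ∙ y ∙ y))            ≈⟨ ∙-congˡ (∙-congˡ (assoc x y y)) ⟩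
    ζ (B y x) ∙ (x ∙ (x ∙ (y ∙ y)))          ≈⟨ ∙-congˡ (assoc x x (y ∙ y)) ⟨
    ζ (B y x) ∙ (x ∙ x ∙ (y ∙ y))            ≈⟨ ∙-congˡ (∙-cong (Q-spec x) (Q-spec y)) ⟩
    ζ (B y x) ∙ (ζ (Q x) ∙ ζ (Q y))          ≈⟨ ∙-congˡ (ζ-xor (Q x) (Q y)) ⟨
    ζ (B y x) ∙ ζ (Q x xor Q y)              ≈⟨ ζ-xor (B y x) (Q x xor Q y) ⟨
    ζ (B y x xor (Q x xor Q y))              ∎))
    (≡.trans (Bool.xor-comm (B y x) _) (cong ((Q x xor Q y) xor_) (B-sym y x)))

  nondegenerate : ∀ {x} → (∀ y → B x y ≡ false) → ∃[ b ] x ≈ ζ b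
  nondegenerate x⊥ = ζ-surjective (λ y → B⇒commute (x⊥ y))

  module V = Group (quotient G (centre G) (centre-normal G))

  ≈⇒V≈ : ∀ {x y} → x ≈ y → x V.≈ y
  ≈⇒V≈ {x} x≈y = Z.resp (sym (x≈y⇒x∙y⁻¹≈ε x≈y)) Z.ε-closed

  V≈⇒ζ : ∀ {x y} → x V.≈ y → ∃[ b ] x ≈ ζ b ∙ y
  V≈⇒ζ {x} {y} e with b , eq ← ζ-surjective e =
    b , trans (sym (//-rightDividesˡ y x)) (∙-congʳ eq)

  ζ⇒V≈ : ∀ b x → ζ b ∙ x V.≈ x
  ζ⇒V≈ b x = Z.resp (sym (//-rightDividesʳ x (ζ b))) (ζ-central b)

  V-square : ∀ x y → x ∙ (x ∙ y) V.≈ y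
  V-square x y = V.trans (≈⇒V≈ (trans (sym (assoc x x y)) (∙-congʳ (Q-spec x)))) (ζ⇒V≈ (Q x) y)

  V-⁻¹ : ∀ x → x ⁻¹ V.≈ x
  V-⁻¹ x = V.trans (V.sym (V-square x (x ⁻¹))) (≈⇒V≈ (trans (∙-congˡ (inverseʳ x)) (identityʳ x)))

  B-V : ∀ w {x y} → x V.≈ y → B w x ≡ B w y
  B-V w {x} {y} e with b , eq ← V≈⇒ζ e =
    ≡.trans (B-cong refl eq) (≡.trans (B-∙ʳ w (ζ b) y)
      (cong (_xor B w y) (≡.trans (B-sym w (ζ b)) (B-ζˡ b w))))

  Q-V : ∀ {x y} → x V.≈ y → Q x ≡ Q y
  Q-V {x} {y} e with b , eq ← V≈⇒ζ e = ≡.trans (Q-cong eq) (≡.trans (Q-∙ (ζ b) y)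
    (≡.trans (cong₂ (λ u v → (u xor Q y) xor v) (Q-ζ b) (B-ζˡ b y)) (Bool.xor-identityʳ (Q y))))

  -- Normality and subgroups above the centre

  ContainsCentre : Subgroup G → Set (c ⊔ ℓ)
  ContainsCentre H = ∀ b → ζ b ∈ member H

  z∈H⇒containsCentre : (H : Subgroup G) → z ∈ member H → ContainsCentre H
  z∈H⇒containsCentre H z∈H false = Subgroup.ε-closed H
  z∈H⇒containsCentre H z∈H true  = z∈H

  conjugate : ∀ g x → g ∙ x ∙ g ⁻¹ ≈ ζ (B g x) ∙ x
  conjugate g x = begin
    g ∙ x ∙ g ⁻¹                  ≈⟨ ∙-congʳ (B-spec g x) ⟩
    ζ (B g x) ∙ (x ∙ g) ∙ g ⁻¹    ≈⟨ assoc _ _ _ ⟩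
    ζ (B g x) ∙ (x ∙ g ∙ g ⁻¹)    ≈⟨ ∙-congˡ (//-rightDividesʳ g x) ⟩
    ζ (B g x) ∙ x                 ∎

  z∈H⇒normal : (H : Subgroup G) → z ∈ member H → IsNormal H
  z∈H⇒normal H z∈H g {x} x∈H = Subgroup.resp H (sym (conjugate g x))
    (Subgroup.∙-closed H (z∈H⇒containsCentre H z∈H (B g x)) x∈H)

  -- If some g does not commute with x, the commutator [g, x] = z lies in H by normality. Otherwise
  -- x is central and different from 1, so x = z.
  normal⇒z∈H : (H : Subgroup G) → IsNontrivial H → IsNormal H → z ∈ member H
  normal⇒z∈H H (x , x∈H , x≉ε) normal
    with any-element? (λ e → ≡.trans (B-cong (sym e) refl)) (λ g → B g x Bool.≟ true)
  ... | yes (g , Bgx) = Subgroup.resp H (begin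
      g ∙ x ∙ g ⁻¹ ∙ x ⁻¹    ≈⟨ ∙-congʳ (conjugate g x) ⟩
      ζ (B g x) ∙ x ∙ x ⁻¹   ≈⟨ //-rightDividesʳ x _ ⟩
      ζ (B g x)              ≈⟨ reflexive (cong ζ Bgx) ⟩
      z                      ∎)
    (Subgroup.∙-closed H (normal g x∈H) (Subgroup.⁻¹-closed H x∈H))
  ... | no none with nondegenerate (λ y →
          ≡.trans (B-sym x y) (Bool.¬-not (λ Byx → none (y , Byx))))
  ...   | false , x≈ε = contradiction x≈ε x≉ε
  ...   | true  , x≈z = Subgroup.resp H x≈z x∈H

  abelian? : (H : Subgroup G) → Decidable (member H) → Dec (IsAbelian H)
  abelian? H H?
    with any-element? (λ e (x∈H , y , y∈H , Bxy) → Subgroup.resp H e x∈H , y , y∈H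
                                                  , ≡.trans (B-cong (sym e) refl) Bxy)
           (λ x → H? x ×-dec any-element?
             (λ e (y∈H , Bxy) → Subgroup.resp H e y∈H , ≡.trans (B-cong refl (sym e)) Bxy)
             (λ y → H? y ×-dec (B x y Bool.≟ true)))
  ... | yes (x , x∈H , y , y∈H , Bxy) = no (λ ab →
    contradiction (≡.trans (≡.sym Bxy) (commute⇒B (ab x∈H y∈H))) λ ())
  ... | no none = yes (λ {x} {y} x∈H y∈H →
    B⇒commute (Bool.¬-not (λ Bxy → none (x , x∈H , y , y∈H , Bxy))))

  V-resp : (H : Subgroup G) → ContainsCentre H → member H Respects V._≈_
  V-resp H ζ∈H {x} {y} e x∈H with b , eq ← V≈⇒ζ (V.sym {x} {y} e) =
    Subgroup.resp H (sym eq) (Subgroup.∙-closed H (ζ∈H b) x∈H)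

  -- Closure under inverses comes for free, because x⁻¹ and x agree modulo the centre.
  V-subgroup : (P : Pred Carrier (c ⊔ ℓ)) → P Respects V._≈_ → ε ∈ P →
               (∀ {x y} → x ∈ P → y ∈ P → x ∙ y ∈ P) → Subgroup G
  V-subgroup P P-resp ε∈P P-∙ = record
    { member    = P
    ; resp      = λ e → P-resp (≈⇒V≈ e)
    ; ε-closed  = ε∈P
    ; ∙-closed  = P-∙
    ; ⁻¹-closed = λ {x} → P-resp (V.sym {x ⁻¹} {x} (V-⁻¹ x))
    }

  -- Double orthogonal complements

  -- A negative answer says that w ∈ L^⊥⊥.
  separating? : ∀ L w → Dec (∃[ y ] All (λ u → B y u ≡ false) L × B y w ≡ true)
  separating? L w = any-element?
    (λ e (y⊥L , Byw) → All.map (≡.trans (B-cong (sym e) refl)) y⊥L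
                     , ≡.trans (B-cong (sym e) refl) Byw)
    (λ y → All.all? (λ u → B y u Bool.≟ false) L ×-dec (B y w Bool.≟ true))

  -- Every subgroup K containing Z and L contains L^⊥⊥. On L^⊥ the functional B(-, w) vanishes
  -- wherever B(-, u) does, so there it is 0 or equals B(-, u). Accordingly w or w u is orthogonal
  -- to L^⊥, and the induction applies to it.
  double-perp : (K : Subgroup G) → ContainsCentre K → ∀ L → All (member K) L → ∀ w →
                (∀ y → All (λ u → B y u ≡ false) L → B y w ≡ false) → w ∈ member K
  double-perp K ζ∈K [] [] w w∈⊥⊥
    with b , eq ← nondegenerate (λ y → ≡.trans (B-sym w y) (w∈⊥⊥ y [])) =
    Subgroup.resp K (sym eq) (ζ∈K b)
  double-perp K ζ∈K (u ∷ L) (u∈K ∷ L⊆K) w w∈⊥⊥ with separating? L w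
  ... | no none = double-perp K ζ∈K L L⊆K w
    (λ y ⊥L → Bool.¬-not (λ Byw → none (y , ⊥L , Byw)))
  ... | yes (y₀ , y₀⊥L , By₀w) = Subgroup.resp K (//-rightDividesʳ u w)
    (Subgroup.∙-closed K
      (double-perp K ζ∈K L L⊆K (w ∙ u) (λ y y⊥L → ≡.trans (B-∙ʳ y w u) (same y y⊥L)))
      (Subgroup.⁻¹-closed K u∈K))
    where
    By₀u : B y₀ u ≡ true
    By₀u = Bool.¬-not (λ By₀u → contradiction (≡.trans (≡.sym By₀w) (w∈⊥⊥ y₀ (By₀u ∷ y₀⊥L))) λ ())

    same : ∀ y → All (λ u → B y u ≡ false) L → B y w xor B y u ≡ false
    same y y⊥L with B y u in Byu
    ... | false = ≡.trans (Bool.xor-identityʳ _) (w∈⊥⊥ y (Byu ∷ y⊥L))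
    -- Here B(y, u) = B(y₀, u) = 1, so y y₀ is orthogonal to u as well as to L, and hence to w.
    ... | true  = ≡.trans (cong (B y w xor_) (≡.sym By₀w)) (≡.trans (≡.sym (B-∙ˡ y y₀ w))
      (w∈⊥⊥ (y ∙ y₀)
        (≡.trans (B-∙ˡ y y₀ u) (cong₂ _xor_ Byu By₀u) ∷
         All.zipWith (λ {v} (p , q) → ≡.trans (B-∙ˡ y y₀ v) (cong₂ _xor_ p q)) (y⊥L , y₀⊥L))))

  perp-perp : (H : Subgroup G) → Decidable (member H) → ContainsCentre H → ∀ w →
              (∀ y → (∀ {h} → h ∈ member H → B y h ≡ false) → B y w ≡ false) → w ∈ member H
  perp-perp H H? ζ∈H w w∈⊥⊥ = double-perp H ζ∈H (elements H H?) (elements-sound H H?) w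
    (λ y y⊥L → w∈⊥⊥ y (elements-complete H H? (λ e → ≡.trans (B-cong refl (sym e))) y⊥L))

  -- Vectors on which Q agrees with B(g, -)

  -- By `Q-∙` this says that Q(g x) = Q(g).
  agreement : Carrier → Pred Carrier 0ℓ
  agreement g x = Q x ≡ B g x

  agreement-∙ : ∀ {g x y} → B x y ≡ false → x ∈ agreement g → y ∈ agreement g →
                x ∙ y ∈ agreement g
  agreement-∙ {g} {x} {y} Bxy p q =
    ≡.trans (Q-∙ x y) (≡.trans (cong₂ _xor_ (cong₂ _xor_ p q) Bxy)
      (≡.trans (Bool.xor-identityʳ _) (≡.sym (B-∙ʳ g x y))))

  -- The polar form of Q + B(g, -) is still B, so vanishing of that sum at x, y and x y leaves B(x,
  -- y) = 0.
  agreement-isotropic : ∀ {g x y} → x ∈ agreement g → y ∈ agreement g →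
                        x ∙ y ∈ agreement g → B x y ≡ false
  agreement-isotropic {g} {x} {y} p q r = xor-fixed⇒false (Q x xor Q y) (≡.trans (≡.sym (Q-∙ x y))
    (≡.trans r (≡.trans (B-∙ʳ g x y) (≡.sym (cong₂ _xor_ p q)))))

  -- If no vector orthogonal to L corrects B(g, w), then w ∈ L^⊥⊥, and agreement
  -- with B(g, -) propagates from L to w.
  representing : (H : Subgroup G) → ContainsCentre H → IsAbelian H →
                 ∀ L → All (member H) L → ∃[ g ] All (agreement g) L
  representing H ζ∈H ab [] [] = ε , []
  representing H ζ∈H ab (w ∷ L) (w∈H ∷ L⊆H) with representing H ζ∈H ab L L⊆H
  ... | g , agree with Q w Bool.≟ B g w
  ...   | yes eq = g , eq ∷ agree
  ...   | no neq with separating? L w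
  ...     | yes (y , y⊥L , Byw) = g ∙ y ,
    ≡.trans (Bool.¬-not neq) (≡.trans (Bool.xor-comm true (B g w))
      (≡.trans (cong (B g w xor_) (≡.sym Byw)) (≡.sym (B-∙ˡ g y w)))) ∷
    All.zipWith (λ {v} (p , q) → ≡.trans p (≡.trans (≡.sym (Bool.xor-identityʳ _))
      (≡.trans (cong (B g v xor_) (≡.sym q)) (≡.sym (B-∙ˡ g y v))))) (agree , y⊥L)
  ...     | no none = contradiction
    (proj₂ (double-perp K (λ b → ζ∈H b , agreement-ζ b) L (All.zip (L⊆H , agree)) w
      (λ y y⊥L → Bool.¬-not (λ Byw → none (y , y⊥L , Byw)))))
    neq
    where
    agreement-ζ : ∀ b → ζ b ∈ agreement g
    agreement-ζ b = ≡.trans (Q-ζ b) (≡.sym (≡.trans (B-sym g (ζ b)) (B-ζˡ b g)))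

    K : Subgroup G
    K = V-subgroup (λ x → x ∈ member H × x ∈ agreement g)
      (λ {x} {y} e (x∈H , p) → V-resp H ζ∈H {x} {y} e x∈H
        , ≡.trans (Q-V {y} {x} (V.sym {x} {y} e)) (≡.trans p (B-V g {x} {y} e)))
      (ζ∈H false , agreement-ζ false)
      (λ (x∈H , p) (y∈H , q) → Subgroup.∙-closed H x∈H y∈H
        , agreement-∙ (commute⇒B (ab x∈H y∈H)) p q)

  -- Lagrangians and exchange

  -- The two inclusions of E = E^⊥, which replaces the condition of having half the dimension.
  record IsLagrangian (E : Subgroup G) : Set (c ⊔ ℓ) where
    field
      isotropic : ∀ {x y} → x ∈ member E → y ∈ member E → B x y ≡ false
      maximal   : ∀ {x} → (∀ {y} → y ∈ member E → B x y ≡ false) → x ∈ member E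

    containsCentre : ContainsCentre E
    containsCentre b = maximal (λ _ → B-ζˡ b _)

  -- On E the functional B(x, -) vanishes on the kernel of B(w, -), so it is 0 or equals B(w, -).
  -- Thus x or x w is orthogonal to E, and E^⊥ = E.
  ⊥-hyperplane : {E : Subgroup G} → Decidable (member E) → IsLagrangian E → ∀ w x →
                 (∀ {u} → u ∈ member E → B w u ≡ false → B x u ≡ false) →
                 x ∈ member E ⊎ x ∙ w ∈ member E
  ⊥-hyperplane {E} E? lagrangian w x x⊥
    with any-element? (λ e (u∈E , Bxu) → Subgroup.resp E e u∈E
                                      , ≡.trans (B-cong refl (sym e)) Bxu)
           (λ u → E? u ×-dec (B x u Bool.≟ true))
  ... | no none = inj₁ (maximal (λ {y} y∈E → Bool.¬-not (λ Bxy → none (y , y∈E , Bxy))))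
    where open IsLagrangian lagrangian
  ... | yes (v , v∈E , Bxv) = inj₂ (maximal (λ {u} u∈E → ≡.trans (B-∙ˡ x w u) (same u u∈E)))
    where
    open IsLagrangian lagrangian

    Bwv : B w v ≡ true
    Bwv = Bool.¬-not (λ Bwv → contradiction (≡.trans (≡.sym Bxv) (x⊥ v∈E Bwv)) λ ())

    same : ∀ u → u ∈ member E → B x u xor B w u ≡ false
    same u u∈E with B w u in Bwu
    ... | false = ≡.trans (Bool.xor-identityʳ _) (x⊥ u∈E Bwu)
    ... | true  = ≡.trans (cong (B x u xor_) (≡.sym Bxv)) (≡.trans (≡.sym (B-∙ʳ x u v))
      (x⊥ (Subgroup.∙-closed E u∈E v∈E) (≡.trans (B-∙ʳ w u v) (cong₂ _xor_ Bwu Bwv))))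

  -- (E ∩ w^⊥)⟨w⟩, which is again Lagrangian.
  module Swap {E : Subgroup G} (E? : Decidable (member E)) (lagrangian : IsLagrangian E)
              (w : Carrier) where
    open IsLagrangian lagrangian

    -- Since w² is central, x w ∈ E expresses x ∈ E w. As w is orthogonal to itself, intersecting E
    -- ∪ E w with w^⊥ gives (E ∩ w^⊥)⟨w⟩.
    Swapped : Pred Carrier (c ⊔ ℓ)
    Swapped x = B w x ≡ false × (x ∈ member E ⊎ x ∙ w ∈ member E)

    private
      E-resp : member E Respects V._≈_
      E-resp = V-resp E containsCentre

      E-∙ : ∀ {x y} → x ∈ member E → y ∈ member E → x ∙ y ∈ member E
      E-∙ = Subgroup.∙-closed E

    Swapped-resp : Swapped Respects V._≈_
    Swapped-resp {x} {y} e (Bwx , inj₁ x∈E) =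
      ≡.trans (B-V w {y} {x} (V.sym {x} {y} e)) Bwx , inj₁ (E-resp {x} {y} e x∈E)
    Swapped-resp {x} {y} e (Bwx , inj₂ xw∈E) =
      ≡.trans (B-V w {y} {x} (V.sym {x} {y} e)) Bwx ,
      inj₂ (E-resp {x ∙ w} {y ∙ w} (V.∙-congʳ {w} {x} {y} e) xw∈E)

    Swapped-∙ : ∀ {x y} → x ∈ Swapped → y ∈ Swapped → x ∙ y ∈ Swapped
    Swapped-∙ {x} {y} (Bwx , x∈) (Bwy , y∈) =
      ≡.trans (B-∙ʳ w x y) (cong₂ _xor_ Bwx Bwy) , product x∈ y∈
      where
      yw~wy : y ∙ w V.≈ w ∙ y
      yw~wy = comm y w

      product : x ∈ member E ⊎ x ∙ w ∈ member E → y ∈ member E ⊎ y ∙ w ∈ member E →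
                x ∙ y ∈ member E ⊎ x ∙ y ∙ w ∈ member E
      product (inj₁ x∈E)  (inj₁ y∈E)  = inj₁ (E-∙ x∈E y∈E)
      product (inj₁ x∈E)  (inj₂ yw∈E) = inj₂ (Subgroup.resp E (sym (assoc x y w)) (E-∙ x∈E yw∈E))
      product (inj₂ xw∈E) (inj₁ y∈E)  = inj₂ (E-resp {x ∙ w ∙ y} {x ∙ y ∙ w}
        (V.trans {x ∙ w ∙ y} {x ∙ (w ∙ y)} {x ∙ y ∙ w} (V.assoc x w y)
          (V.trans {x ∙ (w ∙ y)} {x ∙ (y ∙ w)} {x ∙ y ∙ w}
            (V.∙-congˡ {x} {w ∙ y} {y ∙ w} (comm w y))
            (V.sym {x ∙ y ∙ w} {x ∙ (y ∙ w)} (V.assoc x y w))))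
        (E-∙ xw∈E y∈E))
      product (inj₂ xw∈E) (inj₂ yw∈E) = inj₁ (E-resp {x ∙ w ∙ (y ∙ w)} {x ∙ y}
        (V.trans {x ∙ w ∙ (y ∙ w)} {x ∙ w ∙ (w ∙ y)} {x ∙ y}
          (V.∙-congˡ {x ∙ w} {y ∙ w} {w ∙ y} yw~wy)
          (V.trans {x ∙ w ∙ (w ∙ y)} {x ∙ (w ∙ (w ∙ y))} {x ∙ y} (V.assoc x w (w ∙ y))
            (V.∙-congˡ {x} {w ∙ (w ∙ y)} {y} (V-square w y))))
        (E-∙ xw∈E yw∈E))

    swap : Subgroup G
    swap = V-subgroup Swapped (λ {x} {y} → Swapped-resp {x} {y})
      (≡.trans (B-sym w ε) (B-ζˡ false w) , inj₁ (Subgroup.ε-closed E)) Swapped-∙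

    swap? : Decidable (member swap)
    swap? x = (B w x Bool.≟ false) ×-dec (E? x ⊎-dec E? (x ∙ w))

    w∈swap : w ∈ member swap
    w∈swap = B-self w , inj₂ (Subgroup.resp E (sym (Q-spec w)) (containsCentre (Q w)))

    private
      -- A factor w does not affect pairings with w^⊥, so each element can be replaced by one of E.
      -- Doing this in both arguments reduces isotropy to that of E.
      shadow : ∀ {x} → x ∈ Swapped →
               ∃[ x̂ ] x̂ ∈ member E × B w x̂ ≡ false × (∀ y → B w y ≡ false → B x y ≡ B x̂ y)
      shadow {x} (Bwx , inj₁ x∈E)  = x , x∈E , Bwx , λ _ _ → ≡.refl
      shadow {x} (Bwx , inj₂ xw∈E) = x ∙ w , xw∈E ,
        ≡.trans (B-∙ʳ w x w) (cong₂ _xor_ Bwx (B-self w)) ,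
        λ y Bwy → ≡.sym (≡.trans (B-∙ˡ x w y)
          (≡.trans (cong (B x y xor_) Bwy) (Bool.xor-identityʳ _)))

    swap-lagrangian : IsLagrangian swap
    swap-lagrangian = record
      { isotropic = iso
      ; maximal   = λ {x} x⊥ → ≡.trans (B-sym w x) (x⊥ w∈swap) ,
          ⊥-hyperplane E? lagrangian w x (λ u∈E Bwu → x⊥ (Bwu , inj₁ u∈E))
      }
      where
      iso : ∀ {x y} → x ∈ Swapped → y ∈ Swapped → B x y ≡ false
      iso {x} {y} x∈ y∈ with shadow x∈ | shadow y∈
      ... | x̂ , x̂∈E , Bwx̂ , x~x̂ | ŷ , ŷ∈E , _ , y~ŷ =
        ≡.trans (x~x̂ y (proj₁ y∈)) (≡.trans (B-sym x̂ y)
          (≡.trans (y~ŷ x̂ Bwx̂) (isotropic ŷ∈E x̂∈E)))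

    -- Singularity is asked of E only on w^⊥. This admits a Lagrangian on which Q = B(w, -), where Q
    -- vanishes on exactly that hyperplane.
    swap-singular : Q w ≡ false → (∀ {u} → u ∈ member E → B w u ≡ false → Q u ≡ false) →
                    ∀ {x} → x ∈ member swap → Q x ≡ false
    swap-singular Qw E-singular (Bwx , inj₁ x∈E) = E-singular x∈E Bwx
    swap-singular Qw E-singular {x} (Bwx , inj₂ xw∈E) = begin≡
      Q x                        ≡⟨ Bool.xor-identityʳ (Q x) ⟨
      Q x xor false              ≡⟨ Bool.xor-identityʳ _ ⟨
      (Q x xor false) xor false  ≡⟨ cong₂ (λ a b → (Q x xor a) xor b) Qw (≡.trans (B-sym x w) Bwx) ⟨
      (Q x xor Q w) xor B x w    ≡⟨ Q-∙ x w ⟨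
      Q (x ∙ w)                  ≡⟨ E-singular xw∈E (≡.trans (B-∙ʳ w x w)
                                     (cong₂ _xor_ Bwx (B-self w))) ⟩
      false                      ∎≡
      where open ≡.≡-Reasoning renaming (begin_ to begin≡_; _∎ to _∎≡)

  -- A witness that Q is of plus type, that is, of maximal Witt index.
  record SingularLagrangian : Set (Level.suc (c ⊔ ℓ)) where
    field
      subgroup   : Subgroup G
      decidable  : Decidable (member subgroup)
      lagrangian : IsLagrangian subgroup
      singular   : ∀ {x} → x ∈ member subgroup → Q x ≡ false
    open IsLagrangian lagrangian public

  open SingularLagrangian using (subgroup)

  -- Elements absorbed earlier survive the exchange with w because they are orthogonal to w.
  absorb : {P : Pred Carrier p} → (∀ {x y} → x ∈ P → y ∈ P → B x y ≡ false) →
           (∀ {x} → x ∈ P → Q x ≡ false) → SingularLagrangian → ∀ L → All P L →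
           Σ[ S ∈ SingularLagrangian ] All (member (subgroup S)) L
  absorb isotropicP singularP S [] [] = S , []
  absorb isotropicP singularP S (w ∷ L) (Pw ∷ PL) with absorb isotropicP singularP S L PL
  ... | T , L⊆T = record
    { subgroup   = swap
    ; decidable  = swap?
    ; lagrangian = swap-lagrangian
    ; singular   = swap-singular (singularP Pw) (λ u∈T _ → T.singular u∈T)
    } , w∈swap ∷ All.zipWith (λ (Pu , u∈T) → isotropicP Pw Pu , inj₁ u∈T) (PL , L⊆T)
    where
    module T = SingularLagrangian T
    open Swap T.decidable T.lagrangian w

  -- Cosets containing an element of square 1

  MeetsInvolutions : Subgroup G → Set (c ⊔ ℓ)
  MeetsInvolutions H = ∀ g → ∃[ h ] h ∈ member H × Q (g ∙ h) ≡ false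

  -- A coset gH contains an element of square 1 unless g² = z and h² = [g, h] on H.
  obstruction : (H : Subgroup G) → Decidable (member H) → ∀ g →
                (∃[ h ] h ∈ member H × Q (g ∙ h) ≡ false) ⊎
                (Q g ≡ true × (∀ {h} → h ∈ member H → h ∈ agreement g))
  obstruction H H? g
    with any-element? (λ e (h∈H , Qgh) → Subgroup.resp H e h∈H
                                      , ≡.trans (Q-cong (∙-congˡ (sym e))) Qgh)
           (λ h → H? h ×-dec (Q (g ∙ h) Bool.≟ false))
  ... | yes found = inj₁ found
  ... | no none = inj₂ (Qg , λ {h} h∈H → not-xor≡true⇒≡ (Q h) (B g h)
      (≡.trans (cong (λ b → (b xor Q h) xor B g h) (≡.sym Qg))
        (≡.trans (≡.sym (Q-∙ g h)) (Qgh h∈H))))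
    where
    Qgh : ∀ {h} → h ∈ member H → Q (g ∙ h) ≡ true
    Qgh {h} h∈H = Bool.¬-not (λ e → none (h , h∈H , e))

    Qg : Q g ≡ true
    Qg = ≡.trans (Q-cong (sym (identityʳ g))) (Qgh (Subgroup.ε-closed H))

  nonabelian⇒meets : (H : Subgroup G) → Decidable (member H) → ¬ IsAbelian H → MeetsInvolutions H
  nonabelian⇒meets H H? nonabelian g with obstruction H H? g
  ... | inj₁ found = found
  ... | inj₂ (_ , agree) = ⊥-elim (nonabelian
    (λ x∈H y∈H → B⇒commute (agreement-isotropic (agree x∈H) (agree y∈H)
      (agree (Subgroup.∙-closed H x∈H y∈H)))))

  -- Every x ∈ gH orthogonal to the hyperplane H ∩ g^⊥ has Q(x) = Q(g) = 1, so S
  -- lies in that hyperplane and therefore contains g.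
  hyperplane-maximal : (S : SingularLagrangian) {H : Subgroup G} → Decidable (member H) →
                       IsLagrangian H → ∀ {g} → Q g ≡ true →
                       (∀ {h} → h ∈ member H → h ∈ agreement g) →
                       ¬ (∀ {h} → h ∈ member H → B g h ≡ false → h ∈ member (subgroup S))
  hyperplane-maximal S {H} H? lagrangian {g} Qg agree H∩g⊥⊆S =
    contradiction (≡.trans (≡.sym Qg) (S.singular (S.maximal ⊥S))) λ ()
    where
    module S = SingularLagrangian S

    ⊥S : ∀ {x} → x ∈ member S.subgroup → B g x ≡ false
    ⊥S {x} x∈S with ⊥-hyperplane H? lagrangian g x
                      (λ u∈H Bgu → S.isotropic x∈S (H∩g⊥⊆S u∈H Bgu))
    ... | inj₁ x∈H  = ≡.trans (≡.sym (agree x∈H)) (S.singular x∈S)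
    ... | inj₂ xg∈H = contradiction Bxg≡not (Bool.not-¬ ≡.refl)
      where
      open ≡.≡-Reasoning renaming (begin_ to begin≡_; _∎ to _∎≡)

      Bxg≡not : B x g ≡ not (B x g)
      Bxg≡not = begin≡
        B x g                    ≡⟨ B-sym x g ⟩
        B g x                    ≡⟨ Bool.xor-identityʳ (B g x) ⟨
        B g x xor false          ≡⟨ cong (B g x xor_) (B-self g) ⟨
        B g x xor B g g          ≡⟨ B-∙ʳ g x g ⟨
        B g (x ∙ g)              ≡⟨ agree xg∈H ⟨
        Q (x ∙ g)                ≡⟨ Q-∙ x g ⟩
        (Q x xor Q g) xor B x g  ≡⟨ cong₂ (λ a b → (a xor b) xor B x g) (S.singular x∈S) Qg ⟩
        not (B x g)              ∎≡

  -- For a violating g, agreement turns Q into B(g, -) = 0 on H ∩ g^⊥. The hyperplane is then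
  -- totally singular, as absorption requires.
  lagrangian⇒meets : SingularLagrangian → (H : Subgroup G) → Decidable (member H) →
                     IsLagrangian H → MeetsInvolutions H
  lagrangian⇒meets S H H? lagrangian g with obstruction H H? g
  ... | inj₁ found = found
  ... | inj₂ (Qg , agree) = ⊥-elim (hyperplane-maximal (proj₁ absorbed) H? lagrangian Qg agree
          (λ h∈H Bgh → elements-complete hyperplane hyperplane?
            (Subgroup.resp (subgroup (proj₁ absorbed))) (proj₂ absorbed) (h∈H , Bgh)))
    where
    open IsLagrangian lagrangian

    hyperplane : Subgroup G
    hyperplane = V-subgroup (λ x → x ∈ member H × B g x ≡ false)
      (λ {x} {y} e (x∈H , Bgx) → V-resp H containsCentre {x} {y} e x∈H
        , ≡.trans (B-V g {y} {x} (V.sym {x} {y} e)) Bgx)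
      (Subgroup.ε-closed H , ≡.trans (B-sym g ε) (B-ζˡ false g))
      (λ {x} {y} (x∈H , Bgx) (y∈H , Bgy) → Subgroup.∙-closed H x∈H y∈H
        , ≡.trans (B-∙ʳ g x y) (cong₂ _xor_ Bgx Bgy))

    hyperplane? : Decidable (member hyperplane)
    hyperplane? x = H? x ×-dec (B g x Bool.≟ false)

    absorbed : Σ[ T ∈ SingularLagrangian ]
               All (member (subgroup T)) (elements hyperplane hyperplane?)
    absorbed = absorb {P = member hyperplane} (λ (x∈H , _) (y∈H , _) → isotropic x∈H y∈H)
      (λ (x∈H , Bgx) → ≡.trans (agree x∈H) Bgx) S
      (elements hyperplane hyperplane?) (elements-sound hyperplane hyperplane?)

  meets⇒lagrangian : (H : Subgroup G) → Decidable (member H) → ContainsCentre H → IsAbelian H →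
                     MeetsInvolutions H → IsLagrangian H × SingularLagrangian
  meets⇒lagrangian H H? ζ∈H ab meets = lagrangian , record
    { subgroup   = swap
    ; decidable  = swap?
    ; lagrangian = swap-lagrangian
    ; singular   = swap-singular Qg (λ u∈H Bgu → ≡.trans (agree u∈H) Bgu)
    }
    where
    representative = representing H ζ∈H ab (elements H H?) (elements-sound H H?)

    g : Carrier
    g = proj₁ representative

    agree : ∀ {h} → h ∈ member H → h ∈ agreement g
    agree = elements-complete H H?
      (λ e p → ≡.trans (Q-cong (sym e)) (≡.trans p (B-cong refl e))) (proj₂ representative)

    _∈H⊥ : Carrier → Set (c ⊔ ℓ)
    u ∈H⊥ = ∀ {h} → h ∈ member H → B u h ≡ false

    -- The h that `meets` provides for the coset of g u satisfies Q(h) = B(g, h) = B(g u, h), as u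
    -- is orthogonal to h. Its contributions to Q(g u h) = 0 therefore cancel.
    Qgu : ∀ {u} → u ∈H⊥ → Q (g ∙ u) ≡ false
    Qgu {u} u⊥ with meets (g ∙ u)
    ... | h , h∈H , e = ≡.trans (xor-cancel (Q (g ∙ u)) (Q h)) (≡.trans
      (cong ((Q (g ∙ u) xor Q h) xor_) (≡.trans (agree h∈H) (≡.sym (≡.trans (B-∙ˡ g u h)
        (≡.trans (cong (B g h xor_) (u⊥ h∈H)) (Bool.xor-identityʳ _))))))
      (≡.trans (≡.sym (Q-∙ (g ∙ u) h)) e))
      where
      xor-cancel : ∀ a b → a ≡ (a xor b) xor b
      xor-cancel a b = ≡.sym (≡.trans (Bool.xor-assoc a b b)
        (≡.trans (cong (a xor_) (Bool.xor-same b)) (Bool.xor-identityʳ a)))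

    ε∈H⊥ : ε ∈H⊥
    ε∈H⊥ _ = B-ζˡ false _

    Qg : Q g ≡ false
    Qg = ≡.trans (Q-cong (sym (identityʳ g))) (Qgu ε∈H⊥)

    agree⊥ : ∀ {u} → u ∈H⊥ → u ∈ agreement g
    agree⊥ {u} u⊥ = xor-injective (Q u) (≡.trans (cong (λ b → (b xor Q u) xor B g u) (≡.sym Qg))
      (≡.trans (≡.sym (Q-∙ g u)) (Qgu u⊥)))
      where
      xor-injective : ∀ a {b} → a xor b ≡ false → a ≡ b
      xor-injective false e = ≡.sym e
      xor-injective true  e = ≡.sym (Bool.not-injective e)

    lagrangian : IsLagrangian H
    lagrangian = record
      { isotropic = λ x∈H y∈H → commute⇒B (ab x∈H y∈H)
      -- Agreement with g on all of H^⊥ makes H^⊥ isotropic, so x is orthogonal to each y ∈ H^⊥ and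
      -- lies in H^⊥⊥ = H.
      ; maximal   = λ {x} x⊥ → perp-perp H H? ζ∈H x
          (λ y y⊥ → agreement-isotropic (agree⊥ y⊥) (agree⊥ x⊥) (agree⊥ (λ {h} h∈H →
            ≡.trans (B-∙ˡ y x h) (cong₂ _xor_ (y⊥ h∈H) (x⊥ h∈H)))))
      }

    open Swap H? lagrangian g

  -- Lagrangians as maximal abelian subgroups

  lagrangian⇒maximalAbelian : {H : Subgroup G} → IsLagrangian H → IsMaximalAbelian H
  lagrangian⇒maximalAbelian lagrangian =
    (λ x∈H y∈H → B⇒commute (isotropic x∈H y∈H)) ,
    λ (K , abK , H⊆K , K⊈H) → K⊈H (λ x∈K →
      maximal (λ y∈H → commute⇒B (abK x∈K (H⊆K y∈H))))
    where open IsLagrangian lagrangian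

  maximalAbelian⇒lagrangian : {H : Subgroup G} → Decidable (member H) →
                              IsMaximalAbelian H → IsLagrangian H
  maximalAbelian⇒lagrangian {H} H? (ab , noLarger) = record
    { isotropic = λ x∈H y∈H → commute⇒B (ab x∈H y∈H)
    ; maximal   = λ {k} k⊥ → decidable-stable (H? k) (λ k∉H → noLarger
        (extension k , extension-abelian k⊥ , (λ {x} x∈H → x , x∈H , inj₁ (V.refl {x}))
        , λ K⊆H → k∉H (K⊆H (ε , Subgroup.ε-closed H , inj₂ (V.sym {ε ∙ k} {k} (V.identityˡ k))))))
    }
    where
    open Subgroup H using (∙-closed; ε-closed)

    module _ (k : Carrier) where
      Extension : Pred Carrier (c ⊔ ℓ)
      Extension x = ∃[ h ] h ∈ member H × (x V.≈ h ⊎ x V.≈ h ∙ k)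

      extension : Subgroup G
      extension = V-subgroup Extension
        (λ { {x} {y} e (h , h∈H , inj₁ p) → h , h∈H ,
               inj₁ (V.trans {y} {x} {h} (V.sym {x} {y} e) p)
           ; {x} {y} e (h , h∈H , inj₂ p) → h , h∈H ,
               inj₂ (V.trans {y} {x} {h ∙ k} (V.sym {x} {y} e) p) })
        (ε , ε-closed , inj₁ (V.refl {ε}))
        closed
        where
        closed : ∀ {x y} → x ∈ Extension → y ∈ Extension → x ∙ y ∈ Extension
        closed {x} {y} (h , h∈H , x~) (i , i∈H , y~) = h ∙ i , ∙-closed h∈H i∈H , product x~ y~
          where
          product : x V.≈ h ⊎ x V.≈ h ∙ k → y V.≈ i ⊎ y V.≈ i ∙ k →
                    x ∙ y V.≈ h ∙ i ⊎ x ∙ y V.≈ h ∙ i ∙ k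
          product (inj₁ p) (inj₁ q) = inj₁ (V.∙-cong {x} {h} {y} {i} p q)
          product (inj₁ p) (inj₂ q) = inj₂ (V.trans {x ∙ y} {h ∙ (i ∙ k)} {h ∙ i ∙ k}
            (V.∙-cong {x} {h} {y} {i ∙ k} p q) (V.sym {h ∙ i ∙ k} {h ∙ (i ∙ k)} (V.assoc h i k)))
          product (inj₂ p) (inj₁ q) = inj₂ (V.trans {x ∙ y} {h ∙ k ∙ i} {h ∙ i ∙ k}
            (V.∙-cong {x} {h ∙ k} {y} {i} p q)
            (V.trans {h ∙ k ∙ i} {h ∙ (k ∙ i)} {h ∙ i ∙ k} (V.assoc h k i)
              (V.trans {h ∙ (k ∙ i)} {h ∙ (i ∙ k)} {h ∙ i ∙ k}
                (V.∙-congˡ {h} {k ∙ i} {i ∙ k} (comm k i))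
                (V.sym {h ∙ i ∙ k} {h ∙ (i ∙ k)} (V.assoc h i k)))))
          product (inj₂ p) (inj₂ q) = inj₁ (V.trans {x ∙ y} {h ∙ k ∙ (i ∙ k)} {h ∙ i}
            (V.∙-cong {x} {h ∙ k} {y} {i ∙ k} p q)
            (V.trans {h ∙ k ∙ (i ∙ k)} {h ∙ k ∙ (k ∙ i)} {h ∙ i}
              (V.∙-congˡ {h ∙ k} {i ∙ k} {k ∙ i} (comm i k))
              (V.trans {h ∙ k ∙ (k ∙ i)} {h ∙ (k ∙ (k ∙ i))} {h ∙ i} (V.assoc h k (k ∙ i))
                (V.∙-congˡ {h} {k ∙ (k ∙ i)} {i} (V-square k i)))))

    extension-abelian : ∀ {k} → (∀ {y} → y ∈ member H → B k y ≡ false) → IsAbelian (extension k)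
    extension-abelian {k} k⊥ {x} {y} x∈ y∈ = B⇒commute (⊥-extension x
      (λ h∈H → ≡.trans (B-sym x _) (⊥-extension _ (λ i∈H → commute⇒B (ab h∈H i∈H))
        (≡.trans (B-sym _ k) (k⊥ h∈H)) x∈))
      (≡.trans (B-sym x k) (⊥-extension k k⊥ (B-self k) x∈)) y∈)
      where
      -- One argument at a time: applied with w in H, with w = k and finally with w = x, it makes
      -- the whole extension isotropic.
      ⊥-extension : ∀ w → (∀ {h} → h ∈ member H → B w h ≡ false) → B w k ≡ false →
                    ∀ {x} → x ∈ Extension k → B w x ≡ false
      ⊥-extension w w⊥ Bwk {x} (h , h∈H , inj₁ p) = ≡.trans (B-V w {x} {h} p) (w⊥ h∈H)
      ⊥-extension w w⊥ Bwk {x} (h , h∈H , inj₂ p) = ≡.trans (B-V w {x} {h ∙ k} p)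
        (≡.trans (B-∙ʳ w h k) (cong₂ _xor_ (w⊥ h∈H) Bwk))

  -- Perfect codes and inverse-closed transversals

  module _ (S : ConnectionSet G) where
    private module S = ConnectionSet S

    near⁻ : ∀ {x y} → DistanceAtMost (Cay G S) 1 x y → x ≈ y ⊎ y ∙ x ⁻¹ ∈ S.member
    near⁻ (0 , _ , stop x≈y)            = inj₁ x≈y
    near⁻ (1 , _ , step s (stop w≈y))   = inj₂ (S.resp (∙-congʳ w≈y) s)
    near⁻ (suc (suc _) , s≤s () , _)

    near⁺ : ∀ {x y} → y ∙ x ⁻¹ ∈ S.member → DistanceAtMost (Cay G S) 1 x y
    near⁺ s = 1 , s≤s z≤n , step s (stop refl)

  -- s ∈ S is adjacent to both ε and s², hence s² = ε whenever s² ∈ H.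
  perfectCode⇒meets : (H : Subgroup G) → ContainsCentre H → IsSubgroupPerfectCode G H →
                      MeetsInvolutions H
  perfectCode⇒meets H ζ∈H (S , _ , covers) g with covers g
  ... | y , (y∈H , near) , _ with near⁻ S near
  ...   | inj₁ g≈y = g ⁻¹ , H.⁻¹-closed (H.resp (sym g≈y) y∈H) ,
    ≡.trans (Q-cong (inverseʳ g)) (Q-ζ false)
    where module H = Subgroup H
  -- The inverse g y⁻¹ of the connection element y g⁻¹ lies both in S and in gH.
  ...   | inj₂ s∈S = y ⁻¹ , H.⁻¹-closed y∈H ,
    involution (S.resp (⁻¹-anti-homo-// y g) (S.⁻¹-closed s∈S))
    where
    module H = Subgroup H
    module S = ConnectionSet S

    involution : ∀ {s} → s ∈ S.member → Q s ≡ false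
    involution {s} s∈S with covers s
    ... | _ , _ , unique = Q-unique (trans
      (sym (unique (H.resp (sym (Q-spec s)) (ζ∈H (Q s)) ,
                    near⁺ S (S.resp (sym (//-rightDividesʳ s s)) s∈S))))
      (unique (H.ε-closed , near⁺ S (S.resp (sym (identityˡ (s ⁻¹))) (S.⁻¹-closed s∈S)))))

  -- S ∪ {ε} is an inverse-closed left transversal of H: a coset with an
  -- involution is represented by its first one; the other cosets sH, all of
  -- whose elements have square z, are paired off as sH, szH = s⁻¹H and
  -- represented by t and t⁻¹ = tz, where t is the first element of sH ∪ szH.
  module Transversal (H : Subgroup G) (H? : Decidable (member H))
                     (meets : z ∈ member H → MeetsInvolutions H) where
    private module H = Subgroup H

    infix 4 _∼_ _≲_

    _∼_ : Carrier → Carrier → Set (c ⊔ ℓ)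
    t ∼ s = s ⁻¹ ∙ t ∈ member H

    ∼-resp : ∀ {s t t′} → t ≈ t′ → t ∼ s → t′ ∼ s
    ∼-resp e = H.resp (∙-congˡ e)

    ∼-reflexive : ∀ {s t} → t ≈ s → t ∼ s
    ∼-reflexive {s} e = ∼-resp (sym e) (H.resp (sym (inverseˡ s)) H.ε-closed)

    ∼-sym : ∀ {s t} → t ∼ s → s ∼ t
    ∼-sym {s} {t} e = H.resp (⁻¹-anti-homo-\\ s t) (H.⁻¹-closed e)

    ∼-trans : ∀ {s t u} → u ∼ t → t ∼ s → u ∼ s
    ∼-trans {s} {t} {u} p q = H.resp (begin
      s ⁻¹ ∙ t ∙ (t ⁻¹ ∙ u)    ≈⟨ assoc (s ⁻¹) t (t ⁻¹ ∙ u) ⟩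
      s ⁻¹ ∙ (t ∙ (t ⁻¹ ∙ u))  ≈⟨ ∙-congˡ (\\-leftDividesˡ t u) ⟩
      s ⁻¹ ∙ u                 ∎) (H.∙-closed q p)

    ∼-∙ˡ : ∀ a {s t} → t ∼ s → a ∙ t ∼ a ∙ s
    ∼-∙ˡ a {s} {t} = H.resp (begin
      s ⁻¹ ∙ t                  ≈⟨ ∙-congˡ (\\-leftDividesʳ a t) ⟨
      s ⁻¹ ∙ (a ⁻¹ ∙ (a ∙ t))   ≈⟨ assoc (s ⁻¹) (a ⁻¹) (a ∙ t) ⟨
      s ⁻¹ ∙ a ⁻¹ ∙ (a ∙ t)     ≈⟨ ∙-congʳ (⁻¹-anti-homo-∙ a s) ⟨
      (a ∙ s) ⁻¹ ∙ (a ∙ t)      ∎)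

    ∼-∈ : ∀ {s t} → t ∼ s → s ∈ member H → t ∈ member H
    ∼-∈ {s} {t} t∼s s∈H = H.resp (\\-leftDividesˡ s t) (H.∙-closed s∈H t∼s)

    -- u ∈ sH ∪ szH
    _≲_ : Carrier → Carrier → Set (c ⊔ ℓ)
    u ≲ s = ∃[ b ] ζ b ∙ u ∼ s

    ≲-resp : ∀ {s u u′} → u ≈ u′ → u ≲ s → u′ ≲ s
    ≲-resp e (b , p) = b , ∼-resp (∙-congˡ e) p

    ≲-∼ : ∀ {s t u} → u ≲ t → t ∼ s → u ≲ s
    ≲-∼ (b , p) q = b , ∼-trans p q

    ≲-ζ : ∀ a {s u} → u ≲ s → u ≲ ζ a ∙ s
    ≲-ζ a {u = u} (b , p) = a xor b , ∼-resp (ζ-xor-∙ a b u) (∼-∙ˡ (ζ a) p)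

    InvolutionOf : Carrier → Pred Carrier (c ⊔ ℓ)
    InvolutionOf s u = u ∼ s × Q u ≡ false

    InvolutionOf-resp : ∀ {s} → InvolutionOf s Respects _≈_
    InvolutionOf-resp e (p , Qu) = ∼-resp e p , ≡.trans (Q-cong (sym e)) Qu

    Single : Pred Carrier (c ⊔ ℓ)
    Single s = IsFirst (InvolutionOf s) s

    Paired : Pred Carrier (c ⊔ ℓ)
    Paired s = (∀ {u} → u ∼ s → Q u ≡ true) × ∃[ b ] IsFirst (_≲ s) (ζ b ∙ s)

    Single-resp : Single Respects _≈_
    Single-resp e = first-transport InvolutionOf-resp
      (λ (p , Qu) → ∼-trans p (∼-reflexive e) , Qu)
      (λ (p , Qu) → ∼-trans p (∼-reflexive (sym e)) , Qu) e

    Paired-resp : Paired Respects _≈_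
    Paired-resp e (allz , b , isFirst) =
      (λ p → allz (∼-trans p (∼-reflexive (sym e)))) , b ,
      first-transport ≲-resp (λ p → ≲-∼ p (∼-reflexive e)) (λ p → ≲-∼ p (∼-reflexive (sym e)))
        (∙-congˡ e) isFirst

    -- All squares in a paired coset are z, so s⁻¹ = z s; the case `a = true` is closure under
    -- inverses.
    Paired-ζ : ∀ a {s} → Paired s → Paired (ζ a ∙ s)
    Paired-ζ a {s} (allz , b , isFirst) =
      (λ {u} p → ≡.trans (≡.sym (Q-V {ζ a ∙ u} {u} (ζ⇒V≈ a u)))
        (allz (∼-trans (∼-∙ˡ (ζ a) p) (∼-reflexive (ζ-involutive a s))))) ,
      b xor a ,
      first-transport ≲-resp (≲-ζ a)
        (λ p → ≲-∼ (≲-ζ a p) (∼-reflexive (ζ-involutive a s)))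
        (trans (∙-congˡ (sym (ζ-involutive a s))) (ζ-xor-∙ b a (ζ a ∙ s))) isFirst

    connectionSet : ConnectionSet G
    connectionSet = record
      { member    = λ s → s ∉ member H × (Single s ⊎ Paired s)
      ; resp      = λ
        { e (s∉H , inj₁ p) → s∉H ∘ H.resp (sym e) , inj₁ (Single-resp e p)
        ; e (s∉H , inj₂ p) → s∉H ∘ H.resp (sym e) , inj₂ (Paired-resp e p)
        }
      ; ε-∉       = λ (ε∉H , _) → ε∉H H.ε-closed
      ; ⁻¹-closed = λ (s∉H , p) →
          (λ s⁻¹∈H → s∉H (H.resp (⁻¹-involutive _) (H.⁻¹-closed s⁻¹∈H))) , types-⁻¹ p
      }
      where
      types-⁻¹ : ∀ {s} → Single s ⊎ Paired s → Single (s ⁻¹) ⊎ Paired (s ⁻¹)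
      types-⁻¹ {s} (inj₁ p@((_ , Qs) , _)) = inj₁ (Single-resp (inverseˡ-unique s s
        (trans (Q-spec s) (reflexive (cong ζ Qs)))) p)
      types-⁻¹ {s} (inj₂ p@(allz , _)) = inj₂ (Paired-resp (inverseʳ-unique s (z ∙ s) (begin
        s ∙ (z ∙ s)    ≈⟨ ζ-shift true s s ⟩
        z ∙ (s ∙ s)    ≈⟨ ∙-congˡ (Q-spec s) ⟩
        z ∙ ζ (Q s)    ≈⟨ ∙-congˡ (reflexive (cong ζ (allz (∼-reflexive refl)))) ⟩
        z ∙ z          ≈⟨ z∙z≈ε ⟩
        ε              ∎)) (Paired-ζ true p))

    private module S = ConnectionSet connectionSet

    represented : ∀ g → g ∉ member H → ∃[ s ] s ∈ S.member × s ∼ g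
    represented g g∉H with any-element? InvolutionOf-resp
                             (λ u → H? (g ⁻¹ ∙ u) ×-dec (Q u Bool.≟ false))
    ... | yes some = s , (g∉H ∘ ∼-∈ (∼-sym s∼g) , inj₁ (first-transport InvolutionOf-resp
        (λ (p , Qu) → ∼-trans p (∼-sym s∼g) , Qu) (λ (p , Qu) → ∼-trans p s∼g , Qu)
        refl (proj₂ found))) , s∼g
      where
      found = first InvolutionOf-resp (λ u → H? (g ⁻¹ ∙ u) ×-dec (Q u Bool.≟ false)) some

      s : Carrier
      s = proj₁ found

      s∼g : s ∼ g
      s∼g = proj₁ (proj₁ (proj₂ found))
    ... | no none = s , (g∉H ∘ ∼-∈ (∼-sym s∼g) , inj₂
        ( (λ {u} p → Bool.¬-not (λ Qu → none (u , ∼-trans p s∼g , Qu)))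
        , b
        , first-transport ≲-resp (λ p → ≲-∼ p (∼-sym s∼g)) (λ p → ≲-∼ p s∼g)
            (sym (ζ-involutive b t)) (proj₂ found))) , s∼g
      where
      _≲?_ : ∀ u s → Dec (u ≲ s)
      u ≲? s = map′ (λ { (inj₁ p) → false , p ; (inj₂ p) → true , p })
                    (λ { (false , p) → inj₁ p ; (true , p) → inj₂ p })
                    (H? (s ⁻¹ ∙ (ε ∙ u)) ⊎-dec H? (s ⁻¹ ∙ (z ∙ u)))

      found = first ≲-resp (_≲? g) (g , false , ∼-reflexive (identityˡ g))

      t : Carrier
      t = proj₁ found

      b : Bool
      b = proj₁ (proj₁ (proj₂ found))

      -- Whichever of t and t z lies in gH.
      s : Carrier
      s = ζ b ∙ t

      s∼g : s ∼ g
      s∼g = proj₂ (proj₁ (proj₂ found))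

    -- This keeps t and t z in different cosets of H, so that a paired coset has only one
    -- representative.
    paired⇒z∉H : ∀ {s} → Paired s → z ∉ member H
    paired⇒z∉H {s} (allz , _) z∈H with meets z∈H s
    ... | h , h∈H , Qsh = contradiction
      (≡.trans (≡.sym (allz (H.resp (sym (\\-leftDividesʳ s h)) h∈H))) Qsh) λ ()

    representative-unique : ∀ {s t} → s ∈ S.member → t ∈ S.member → s ∼ t → s ≈ t
    representative-unique (_ , inj₁ p) (_ , inj₁ q) s∼t = first-unique
      (first-transport InvolutionOf-resp (λ (r , Qu) → ∼-trans r s∼t , Qu)
        (λ (r , Qu) → ∼-trans r (∼-sym s∼t) , Qu) refl p) q
    representative-unique (_ , inj₁ ((_ , Qs) , _)) (_ , inj₂ (allz , _)) s∼t =
      contradiction (≡.trans (≡.sym (allz s∼t)) Qs) λ ()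
    representative-unique (_ , inj₂ (allz , _)) (_ , inj₁ ((_ , Qt) , _)) s∼t =
      contradiction (≡.trans (≡.sym (allz (∼-sym s∼t))) Qt) λ ()
    representative-unique {s} {t} (_ , inj₂ p@(_ , a , isFirst)) (_ , inj₂ (_ , b , isFirst′)) s∼t =
      cases (a xor b) (begin
        s                        ≈⟨ ζ-involutive a s ⟨
        ζ a ∙ (ζ a ∙ s)          ≈⟨ ∙-congˡ (first-unique (first-transport ≲-resp
                                      (λ r → ≲-∼ r s∼t) (λ r → ≲-∼ r (∼-sym s∼t)) refl isFirst)
                                      isFirst′) ⟩
        ζ a ∙ (ζ b ∙ t)          ≈⟨ ζ-xor-∙ a b t ⟩
        ζ (a xor b) ∙ t          ∎)
      where
      cases : ∀ b → s ≈ ζ b ∙ t → s ≈ t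
      cases false e = trans e (identityˡ t)
      cases true  e = contradiction (H.resp (begin
        t ⁻¹ ∙ s        ≈⟨ ∙-congˡ e ⟩
        t ⁻¹ ∙ (z ∙ t)  ≈⟨ ζ-shift true (t ⁻¹) t ⟩
        z ∙ (t ⁻¹ ∙ t)  ≈⟨ ∙-congˡ (inverseˡ t) ⟩
        z ∙ ε           ≈⟨ identityʳ z ⟩
        z               ∎) s∼t) (paired⇒z∉H p)

    perfectCode : IsSubgroupPerfectCode G H
    perfectCode = connectionSet ,
      (λ x∈H y∈H (yx⁻¹∉H , _) → yx⁻¹∉H (H.∙-closed y∈H (H.⁻¹-closed x∈H))) , covers
      where
      flip∈ : ∀ {x y} → y ∙ x ⁻¹ ∈ S.member → x ∙ y ⁻¹ ∈ S.member
      flip∈ {x} {y} p = S.resp (⁻¹-anti-homo-// y x) (S.⁻¹-closed p)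

      covers : ∀ x → ∃! _≈_ λ y → y ∈ member H × DistanceAtMost (Cay G connectionSet) 1 x y
      covers x with H? x
      ... | yes x∈H = x , (x∈H , 0 , z≤n , stop refl) , unique
        where
        unique : ∀ {y} → y ∈ member H × DistanceAtMost (Cay G connectionSet) 1 x y → x ≈ y
        unique (y∈H , near) with near⁻ connectionSet near
        ... | inj₁ x≈y      = x≈y
        ... | inj₂ (∉H , _) = contradiction (H.∙-closed y∈H (H.⁻¹-closed x∈H)) ∉H
      ... | no x∉H with represented x x∉H
      -- A neighbour y ∈ H of x has x y⁻¹ in S ∩ xH. This set consists of s alone, and x y⁻¹ = s
      -- determines y.
      ...   | s , s∈S , s∼x = (x ⁻¹ ∙ s) ⁻¹ ,
        (H.⁻¹-closed s∼x , near⁺ connectionSet (S.resp (sym quotient≈) (S.⁻¹-closed s∈S))) ,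
        unique
        where
        x·≈s : x ∙ (x ⁻¹ ∙ s) ≈ s
        x·≈s = \\-leftDividesˡ x s

        quotient≈ : (x ⁻¹ ∙ s) ⁻¹ ∙ x ⁻¹ ≈ s ⁻¹
        quotient≈ = trans (sym (⁻¹-anti-homo-∙ x (x ⁻¹ ∙ s))) (⁻¹-cong x·≈s)

        unique : ∀ {y} → y ∈ member H × DistanceAtMost (Cay G connectionSet) 1 x y →
                 (x ⁻¹ ∙ s) ⁻¹ ≈ y
        unique {y} (y∈H , near) with near⁻ connectionSet near
        ... | inj₁ x≈y = contradiction (H.resp (sym x≈y) y∈H) x∉H
        ... | inj₂ yx⁻¹∈S = ⁻¹-injective (trans (⁻¹-involutive _) (∙-cancelˡ x _ _
          (trans x·≈s (representative-unique s∈S (flip∈ yx⁻¹∈S)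
            (∼-trans s∼x (∼-sym (H.resp (sym (\\-leftDividesʳ x (y ⁻¹))) (H.⁻¹-closed y∈H))))))))

  -- A singular Lagrangian from an isomorphism

  module _ {m : ℕ} (iso : G ≅ G⟨ m ,1⟩) where
    private
      module W = CentralPower m
      open IsGroupIsomorphism (proj₂ iso)
        using (∙-homo; ⟦⟧-cong; ε-homo; ⁻¹-homo; injective; surjective)

      f : Carrier → W.Carrier
      f = proj₁ iso

      -- The product of one Klein four-group from each dihedral factor, pulled back to G.
      E : Subgroup G
      E = record
        { member    = λ x → Level.Lift (c ⊔ ℓ) (∀ i → Klein (f x i))
        ; resp      = λ {x} {y} e (Level.lift Kx) →
            Level.lift λ i → W.Klein-resp {f x} {f y} (⟦⟧-cong e) i (Kx i)
        ; ε-closed  = Level.lift λ i → W.Klein-resp {W.ε} {f ε} (W.sym {f ε} {W.ε} ε-homo) i ≡.refl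
        ; ∙-closed  = λ {x} {y} (Level.lift Kx) (Level.lift Ky) → Level.lift λ i →
            W.Klein-resp {f x W.∙ f y} {f (x ∙ y)}
              (W.sym {f (x ∙ y)} {f x W.∙ f y} (∙-homo x y)) i
              (Klein-∙ (f x i) (f y i) (Kx i) (Ky i))
        ; ⁻¹-closed = λ {x} (Level.lift Kx) → Level.lift λ i →
            W.Klein-resp {f x W.⁻¹} {f (x ⁻¹)}
              (W.sym {f (x ⁻¹)} {f x W.⁻¹} (⁻¹-homo x)) i (Klein-⁻¹ (f x i) (Kx i))
        }

      E-singular : ∀ {x} → x ∈ member E → Q x ≡ false
      E-singular {x} (Level.lift Kx) = Q-unique (injective (
        W.trans {f (x ∙ x)} {f x W.∙ f x} {f ε} (∙-homo x x)
          (W.trans {f x W.∙ f x} {W.ε} {f ε} (W.pointwise (λ i → Klein-square (f x i) (Kx i)))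
            (W.sym {f ε} {W.ε} ε-homo))))

      E-isotropic : ∀ {x y} → x ∈ member E → y ∈ member E → B x y ≡ false
      E-isotropic {x} {y} x∈E y∈E = xor-fixed⇒false (Q x xor Q y)
        (≡.trans (≡.sym (Q-∙ x y)) (≡.trans (E-singular (Subgroup.∙-closed E x∈E y∈E))
          (≡.sym (cong₂ _xor_ (E-singular x∈E) (E-singular y∈E)))))

      -- The elements with a single reflection in coordinate i belong to E, and commuting with them
      -- forces coordinate i into the Klein subgroup.
      E-maximal : ∀ {x} → (∀ {y} → y ∈ member E → B x y ≡ false) → x ∈ member E
      E-maximal {x} x⊥ = Level.lift λ i → W.centralizes-reflection {f x} i (commutes i)
        where
        commutes : ∀ i → f x W.∙ W.single i reflection W.≈ W.single i reflection W.∙ f x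
        commutes i with surjective (W.single i reflection)
        ... | y , fy≈ =
          W.trans {f x W.∙ δ} {f x W.∙ f y} {δ W.∙ f x}
            (W.∙-congˡ {f x} {δ} {f y} (W.sym {f y} {δ} (fy≈ refl)))
          (W.trans {f x W.∙ f y} {f (x ∙ y)} {δ W.∙ f x}
            (W.sym {f (x ∙ y)} {f x W.∙ f y} (∙-homo x y))
          (W.trans {f (x ∙ y)} {f (y ∙ x)} {δ W.∙ f x} (⟦⟧-cong (B⇒commute (x⊥ y∈E)))
          (W.trans {f (y ∙ x)} {f y W.∙ f x} {δ W.∙ f x} (∙-homo y x)
            (W.∙-congʳ {f x} {f y} {δ} (fy≈ refl)))))
          where
          δ = W.single i reflection

          y∈E : y ∈ member E
          y∈E = Level.lift λ j → W.Klein-resp {δ} {f y} (W.sym {f y} {δ} (fy≈ refl)) j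
            (W.single-Klein i ≡.refl j)

    isomorphism⇒singularLagrangian : SingularLagrangian
    isomorphism⇒singularLagrangian = record
      { subgroup   = E
      ; decidable  = λ x → map′ Level.lift Level.lower (Fin.all? (λ i → Klein? (f x i)))
      ; lagrangian = record { isotropic = E-isotropic ; maximal = E-maximal }
      ; singular   = E-singular
      }

  -- Dihedral subgroups of G

  open Products G
  open Mult monoid using () renaming (_×_ to _⋆_; ×-homo-+ to ⋆-homo-+)

  infixr 8 _^ᵇ_

  _^ᵇ_ : Carrier → Bool → Carrier
  x ^ᵇ false = ε
  x ^ᵇ true  = x

  -- A homomorphism once r² = z, s² = 1 and [s, r] = z; it then carries the centre of D₈ onto Z.
  φ : Carrier → Carrier → D.Carrier → Carrier
  φ r s (k , b) = toℕ k ⋆ r ∙ s ^ᵇ b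

  double-∙ : ∀ r x → r ∙ (r ∙ x) ≈ ζ (Q r) ∙ x
  double-∙ r x = trans (sym (assoc r r x)) (∙-congʳ (Q-spec r))

  -- Since r² is central of order at most 2, r⁴ = 1 for every r.
  ⋆-% : ∀ r k → (k % 4) ⋆ r ≈ k ⋆ r
  ⋆-% r 0 = refl
  ⋆-% r 1 = refl
  ⋆-% r 2 = refl
  ⋆-% r 3 = refl
  ⋆-% r (suc (suc (suc (suc k)))) = begin
    (k % 4) ⋆ r                    ≈⟨ ⋆-% r k ⟩
    k ⋆ r                          ≈⟨ ζ-involutive (Q r) (k ⋆ r) ⟨
    ζ (Q r) ∙ (ζ (Q r) ∙ k ⋆ r)    ≈⟨ ∙-congˡ (double-∙ r (k ⋆ r)) ⟨
    ζ (Q r) ∙ (r ∙ (r ∙ k ⋆ r))    ≈⟨ double-∙ r _ ⟨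
    r ∙ (r ∙ (r ∙ (r ∙ k ⋆ r)))    ∎

  ⋆-mod : ∀ r i j → toℕ ((toℕ i + toℕ j) mod 4) ⋆ r ≈ toℕ {4} i ⋆ r ∙ toℕ {4} j ⋆ r
  ⋆-mod r i j = begin
    toℕ ((toℕ i + toℕ j) mod 4) ⋆ r   ≈⟨ reflexive (cong (_⋆ r)
                                           (Fin.toℕ-fromℕ< (m%n<n (toℕ i + toℕ j) 4))) ⟩
    ((toℕ i + toℕ j) % 4) ⋆ r         ≈⟨ ⋆-% r (toℕ i + toℕ j) ⟩
    (toℕ i + toℕ j) ⋆ r               ≈⟨ ⋆-homo-+ r (toℕ i) (toℕ j) ⟩
    toℕ i ⋆ r ∙ toℕ j ⋆ r             ∎

  -- The upper binary digit of k, `odd` being the lower one: for r² = z it is the exponent of z in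
  -- r^k.
  high : Fin 4 → Bool
  high 0F = false
  high 1F = false
  high 2F = true
  high 3F = true

  ⋆-normal : ∀ {r} → Q r ≡ true → ∀ k → toℕ k ⋆ r ≈ ζ (high k) ∙ r ^ᵇ odd k
  ⋆-normal Qr 0F = sym (identityˡ ε)
  ⋆-normal {r} Qr 1F = trans (identityʳ r) (sym (identityˡ r))
  ⋆-normal {r} Qr 2F = trans (double-∙ r ε) (∙-congʳ (reflexive (cong ζ Qr)))
  ⋆-normal {r} Qr 3F = trans (double-∙ r (r ∙ ε))
    (∙-cong (reflexive (cong ζ Qr)) (identityʳ r))

  B-^ : ∀ w x b → B w (x ^ᵇ b) ≡ b ∧ B w x
  B-^ w x false = ≡.trans (B-sym w ε) (B-ζˡ false w)
  B-^ w x true  = ≡.refl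

  φ-B : ∀ {r} → Q r ≡ true → ∀ s w k b → B w (φ r s (k , b)) ≡ (odd k ∧ B w r) xor (b ∧ B w s)
  φ-B {r} Qr s w k b = ≡.trans (B-∙ʳ w (toℕ k ⋆ r) (s ^ᵇ b)) (cong₂ _xor_
    (≡.trans (B-cong refl (⋆-normal Qr k))
      (≡.trans (B-V w {ζ (high k) ∙ r ^ᵇ odd k} {r ^ᵇ odd k} (ζ⇒V≈ (high k) (r ^ᵇ odd k)))
        (B-^ w r (odd k))))
    (B-^ w s b))

  φ-⊥ : ∀ {r s w} → Q r ≡ true → B w r ≡ false → B w s ≡ false → ∀ u → B w (φ r s u) ≡ false
  φ-⊥ {r} {s} {w} Qr Bwr Bws (k , b) = ≡.trans (φ-B Qr s w k b)
    (cong₂ _xor_ (≡.trans (cong (odd k ∧_) Bwr) (Bool.∧-zeroʳ (odd k)))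
                 (≡.trans (cong (b ∧_) Bws) (Bool.∧-zeroʳ b)))

  φ-κ : ∀ {r s} → Q r ≡ true → ∀ b → φ r s (κ b) ≈ ζ b
  φ-κ Qr false = identityˡ ε
  φ-κ Qr true  = trans (identityʳ _) (trans (⋆-normal Qr 2F) (identityʳ z))

  φ-homo : ∀ {r s} → Q r ≡ true → Q s ≡ false → B s r ≡ true →
           ∀ u v → φ r s (u D.∙ v) ≈ φ r s u ∙ φ r s v
  φ-homo {r} {s} Qr Qs Bsr = homo
    where
    flip-normal : ∀ a b k → B s (r ^ᵇ odd k) ≡ b → high k ≡ a →
                  s ∙ toℕ k ⋆ r ≈ ζ (a xor b) ∙ r ^ᵇ odd k ∙ s
    flip-normal a b k ≡.refl ≡.refl = begin
      s ∙ toℕ k ⋆ r                            ≈⟨ ∙-congˡ (⋆-normal Qr k) ⟩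
      s ∙ (ζ a ∙ r ^ᵇ odd k)                    ≈⟨ ζ-shift a s _ ⟩
      ζ a ∙ (s ∙ r ^ᵇ odd k)                    ≈⟨ ∙-congˡ (B-spec s _) ⟩
      ζ a ∙ (ζ b ∙ (r ^ᵇ odd k ∙ s))            ≈⟨ ζ-xor-∙ a b _ ⟩
      ζ (a xor b) ∙ (r ^ᵇ odd k ∙ s)            ≈⟨ assoc _ _ _ ⟨
      ζ (a xor b) ∙ r ^ᵇ odd k ∙ s              ∎

    neg : Fin 4 → Fin 4
    neg 0F = 0F
    neg 1F = 3F
    neg 2F = 2F
    neg 3F = 1F

    -- Both sides are compared in normal form: k and -k have the same parity, and their upper digits
    -- differ by exactly the commutator bit of s with r^k.
    flip-⋆ : ∀ k → s ∙ toℕ k ⋆ r ≈ toℕ (neg k) ⋆ r ∙ s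
    flip-⋆ 0F = trans (flip-normal false false 0F (B-^ s r false) ≡.refl)
                      (∙-congʳ (sym (⋆-normal Qr 0F)))
    flip-⋆ 1F = trans (flip-normal false true 1F Bsr ≡.refl)
                      (∙-congʳ (sym (⋆-normal Qr 3F)))
    flip-⋆ 2F = trans (flip-normal true false 2F (B-^ s r false) ≡.refl)
                      (∙-congʳ (sym (⋆-normal Qr 2F)))
    flip-⋆ 3F = trans (flip-normal true true 3F Bsr ≡.refl)
                      (∙-congʳ (sym (⋆-normal Qr 1F)))

    s^not : ∀ b → s ^ᵇ not b ≈ s ∙ s ^ᵇ b
    s^not false = sym (identityʳ s)
    s^not true  = sym (trans (Q-spec s) (reflexive (cong ζ Qs)))

    homo-reflection : ∀ i j b → toℕ ((toℕ i + toℕ (neg j)) mod 4) ⋆ r ∙ s ^ᵇ not b ≈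
                      toℕ {4} i ⋆ r ∙ s ∙ (toℕ j ⋆ r ∙ s ^ᵇ b)
    homo-reflection i j b = begin
      toℕ ((toℕ i + toℕ (neg j)) mod 4) ⋆ r ∙ s ^ᵇ not b
                                      ≈⟨ ∙-cong (⋆-mod r i (neg j)) (s^not b) ⟩
      i⋆r ∙ toℕ (neg j) ⋆ r ∙ (s ∙ s ^ᵇ b)    ≈⟨ assoc _ s (s ^ᵇ b) ⟨
      i⋆r ∙ toℕ (neg j) ⋆ r ∙ s ∙ s ^ᵇ b      ≈⟨ ∙-congʳ (assoc i⋆r _ s) ⟩
      i⋆r ∙ (toℕ (neg j) ⋆ r ∙ s) ∙ s ^ᵇ b    ≈⟨ ∙-congʳ (∙-congˡ (flip-⋆ j)) ⟨
      i⋆r ∙ (s ∙ toℕ j ⋆ r) ∙ s ^ᵇ b          ≈⟨ ∙-congʳ (assoc i⋆r s _) ⟨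
      i⋆r ∙ s ∙ toℕ j ⋆ r ∙ s ^ᵇ b            ≈⟨ assoc _ _ _ ⟩
      i⋆r ∙ s ∙ (toℕ j ⋆ r ∙ s ^ᵇ b)          ∎
      where i⋆r = toℕ i ⋆ r

    homo : ∀ u v → φ r s (u D.∙ v) ≈ φ r s u ∙ φ r s v
    homo (i , false) (j , b) = begin
      toℕ ((toℕ i + toℕ j) mod 4) ⋆ r ∙ s ^ᵇ b    ≈⟨ ∙-congʳ (⋆-mod r i j) ⟩
      toℕ i ⋆ r ∙ toℕ j ⋆ r ∙ s ^ᵇ b              ≈⟨ assoc _ _ _ ⟩
      toℕ i ⋆ r ∙ (toℕ j ⋆ r ∙ s ^ᵇ b)            ≈⟨ ∙-congʳ (identityʳ _) ⟨
      toℕ i ⋆ r ∙ ε ∙ (toℕ j ⋆ r ∙ s ^ᵇ b)        ∎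
    -- The multiplication of D₈ negates j by its own case distinction, so j is made concrete for
    -- both sides to reduce.
    homo (i , true) (0F , b) = homo-reflection i 0F b
    homo (i , true) (1F , b) = homo-reflection i 1F b
    homo (i , true) (2F , b) = homo-reflection i 2F b
    homo (i , true) (3F , b) = homo-reflection i 3F b

  B-product-⊥ : ∀ {n w} {x : Vector Carrier n} → (∀ i → B w (x i) ≡ false) →
                B w (product x) ≡ false
  B-product-⊥ {zero}  {w} w⊥x = ≡.trans (B-sym w ε) (B-ζˡ false w)
  B-product-⊥ {suc n} {w} w⊥x = ≡.trans (B-∙ʳ w _ _)
    (cong₂ _xor_ (w⊥x zero) (B-product-⊥ (w⊥x ∘ suc)))

  B-product-single : ∀ {n w} {x : Vector Carrier n} i → (∀ j → j ≢ i → B w (x j) ≡ false) →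
                     B w (product x) ≡ B w (x i)
  B-product-single {w = w} {x} zero w⊥x = ≡.trans (B-∙ʳ w _ _)
    (≡.trans (cong (B w (x zero) xor_) (B-product-⊥ (λ j → w⊥x (suc j) λ ())))
      (Bool.xor-identityʳ _))
  B-product-single {w = w} {x} (suc i) w⊥x = ≡.trans (B-∙ʳ w _ _)
    (cong₂ _xor_ (w⊥x zero λ ()) (B-product-single i
      (λ j j≢i → w⊥x (suc j) (j≢i ∘ Fin.suc-injective))))

  product-∈ : (H : Subgroup G) → ∀ {n} {x : Vector Carrier n} → (∀ i → x i ∈ member H) →
              product x ∈ member H
  product-∈ H {zero}  x∈H = Subgroup.ε-closed H
  product-∈ H {suc n} x∈H = Subgroup.∙-closed H (x∈H zero) (product-∈ H (x∈H ∘ suc))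

  -- A single bit records the product in Z(D₈) and in Z(G). Hence the central relations factored out
  -- of D₈ⁿ are the central elements that become trivial in G.
  central-product : ∀ {n} {u : Vector D.Carrier n} {x : Vector Carrier n} →
                    (∀ i → ∃[ b ] u i ≡ κ b × x i ≈ ζ b) →
                    ∃[ b ] Products.product D₈ u ≡ κ b × product x ≈ ζ b
  central-product {zero}  ux = false , ≡.refl , refl
  central-product {suc n} ux with ux zero | central-product (ux ∘ suc)
  ... | a , u≡ , x≈ | b , us≡ , xs≈ = a xor b ,
    ≡.trans (cong₂ D._∙_ u≡ us≡) (κ-xor a b) , trans (∙-cong x≈ xs≈) (sym (ζ-xor a b))

  -- Hyperbolic bases and the isomorphism with the central power

  module Splitting (S : SingularLagrangian) where
    private
      module S = SingularLagrangian S

      E : Subgroup G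
      E = S.subgroup

    -- Hyperbolic pairs in dihedral form: r i has square z, so that r i and s i generate a copy of
    -- D₈. The usual singular partner of s i is the product of r i and s i.
    record Hyperbolic (n : ℕ) : Set (c ⊔ ℓ) where
      field
        r s   : Vector Carrier n
        s∈E   : ∀ i → s i ∈ member E
        Q-r   : ∀ i → Q (r i) ≡ true
        B-rs  : ∀ i → B (r i) (s i) ≡ true
        B-rs′ : ∀ {i j} → i ≢ j → B (r i) (s j) ≡ false
        B-rr  : ∀ i j → B (r i) (r j) ≡ false

      Φ : Vector D.Carrier n → Carrier
      Φ v = product (λ i → φ (r i) (s i) (v i))

      B-sr : ∀ i → B (s i) (r i) ≡ true
      B-sr i = ≡.trans (B-sym (s i) (r i)) (B-rs i)

      B-sr′ : ∀ {i j} → i ≢ j → B (s i) (r j) ≡ false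
      B-sr′ i≢j = ≡.trans (B-sym _ _) (B-rs′ (i≢j ∘ ≡.sym))

      B-ss : ∀ i j → B (s i) (s j) ≡ false
      B-ss i j = S.isotropic (s∈E i) (s∈E j)

      Φ-⊥ : ∀ {w} → (∀ i → B (r i) w ≡ false) → (∀ i → B (s i) w ≡ false) →
            ∀ v → B w (Φ v) ≡ false
      Φ-⊥ {w} r⊥w s⊥w v = B-product-⊥ (λ i → φ-⊥ (Q-r i)
        (≡.trans (B-sym w (r i)) (r⊥w i)) (≡.trans (B-sym w (s i)) (s⊥w i)) (v i))

      B-r-Φ : ∀ i v → B (r i) (Φ v) ≡ proj₂ (v i)
      B-r-Φ i v = begin≡
        B (r i) (Φ v)
          ≡⟨ B-product-single i (λ j j≢i → φ-⊥ (Q-r j) (B-rr i j) (B-rs′ (j≢i ∘ ≡.sym)) (v j)) ⟩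
        B (r i) (φ (r i) (s i) (v i))
          ≡⟨ φ-B (Q-r i) (s i) (r i) (proj₁ (v i)) (proj₂ (v i)) ⟩
        (odd (proj₁ (v i)) ∧ B (r i) (r i)) xor (proj₂ (v i) ∧ B (r i) (s i))
          ≡⟨ cong₂ _xor_ (cong (odd (proj₁ (v i)) ∧_) (B-rr i i)) (cong (proj₂ (v i) ∧_) (B-rs i)) ⟩
        (odd (proj₁ (v i)) ∧ false) xor (proj₂ (v i) ∧ true)
          ≡⟨ cong₂ _xor_ (Bool.∧-zeroʳ (odd (proj₁ (v i)))) (Bool.∧-identityʳ (proj₂ (v i))) ⟩
        proj₂ (v i) ∎≡
        where open ≡.≡-Reasoning renaming (begin_ to begin≡_; _∎ to _∎≡)

      B-s-Φ : ∀ i v → B (s i) (Φ v) ≡ odd (proj₁ (v i))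
      B-s-Φ i v = begin≡
        B (s i) (Φ v)
          ≡⟨ B-product-single i (λ j j≢i → φ-⊥ (Q-r j) (B-sr′ (j≢i ∘ ≡.sym)) (B-ss i j) (v j)) ⟩
        B (s i) (φ (r i) (s i) (v i))
          ≡⟨ φ-B (Q-r i) (s i) (s i) (proj₁ (v i)) (proj₂ (v i)) ⟩
        (odd (proj₁ (v i)) ∧ B (s i) (r i)) xor (proj₂ (v i) ∧ B (s i) (s i))
          ≡⟨ cong₂ _xor_ (cong (odd (proj₁ (v i)) ∧_) (B-sr i)) (cong (proj₂ (v i) ∧_) (B-ss i i)) ⟩
        (odd (proj₁ (v i)) ∧ true) xor (proj₂ (v i) ∧ false)
          ≡⟨ cong₂ _xor_ (Bool.∧-identityʳ (odd (proj₁ (v i)))) (Bool.∧-zeroʳ (proj₂ (v i))) ⟩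
        odd (proj₁ (v i)) xor false
          ≡⟨ Bool.xor-identityʳ _ ⟩
        odd (proj₁ (v i)) ∎≡
        where open ≡.≡-Reasoning renaming (begin_ to begin≡_; _∎ to _∎≡)

      Φ-cong : ∀ {u v} → (∀ i → u i ≡ v i) → Φ u ≈ Φ v
      Φ-cong u≡v = product-cong (λ i → reflexive (cong (φ (r i) (s i)) (u≡v i)))

      Φ-homo : ∀ u v → Φ (λ i → u i D.∙ v i) ≈ Φ u ∙ Φ v
      Φ-homo u v = trans
        (product-cong (λ i → φ-homo (Q-r i) (S.singular (s∈E i)) (B-sr i) (u i) (v i)))
        (product-∙ (λ i j i≢j → B⇒commute (φ-⊥ (Q-r j)
          (≡.trans (B-sym _ (r j)) (φ-⊥ (Q-r i) (B-rr j i) (B-rs′ (i≢j ∘ ≡.sym)) (v i)))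
          (≡.trans (B-sym _ (s j)) (φ-⊥ (Q-r i) (B-sr′ (i≢j ∘ ≡.sym)) (B-ss j i) (v i)))
          (u j))))

      -- The vectors r i and s i are dual to each other, so the exponent of r i is read off by
      -- pairing with s i, and conversely.
      coordinates : Carrier → Vector D.Carrier n
      coordinates x i = rotation (B (s i) x) , B (r i) x

      -- The component of x orthogonal to all pairs. Multiplying by Φ instead of its inverse changes
      -- it only by a central element.
      remainder : Carrier → Carrier
      remainder x = x ∙ Φ (coordinates x)

      r⊥remainder : ∀ x i → B (r i) (remainder x) ≡ false
      r⊥remainder x i = ≡.trans (B-∙ʳ (r i) x _)
        (≡.trans (cong (B (r i) x xor_) (B-r-Φ i (coordinates x))) (Bool.xor-same (B (r i) x)))

      s⊥remainder : ∀ x i → B (s i) (remainder x) ≡ false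
      s⊥remainder x i = ≡.trans (B-∙ʳ (s i) x _)
        (≡.trans (cong (B (s i) x xor_)
          (≡.trans (B-s-Φ i (coordinates x)) (odd-rotation (B (s i) x))))
          (Bool.xor-same (B (s i) x)))

      -- Amounts to the s i generating E modulo the centre.
      Complete : Set (c ⊔ ℓ)
      Complete = ∀ {x} → x ∈ member E → (∀ i → B (r i) x ≡ false) → ∃[ b ] x ≈ ζ b

    open Hyperbolic using (r; s; B-rs; B-rs′; Complete)

    trivial : Hyperbolic 0
    trivial = record
      { r = λ () ; s = λ () ; s∈E = λ () ; Q-r = λ ()
      ; B-rs = λ () ; B-rs′ = λ { {()} } ; B-rr = λ () }

    -- The partner of a is y stripped of its components along the existing pairs. Should it have
    -- square 1, multiplying it by a corrects this: Q becomes 0 + 0 + B(y₀, a) = 1.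
    extend : ∀ {n} (𝓗 : Hyperbolic n) {a y} → a ∈ member E → (∀ i → B (r 𝓗 i) a ≡ false) →
             B a y ≡ true → Hyperbolic (suc n)
    extend {n} 𝓗 {a} {y} a∈E r⊥a Bay = adjoin (Q y₀) ≡.refl
      where
      module 𝓗 = Hyperbolic 𝓗

      s⊥a : ∀ i → B (𝓗.s i) a ≡ false
      s⊥a i = S.isotropic (𝓗.s∈E i) a∈E

      y₀ : Carrier
      y₀ = 𝓗.remainder y

      By₀a : B y₀ a ≡ true
      By₀a = ≡.trans (B-sym y₀ a) (≡.trans (B-∙ʳ a y _)
        (cong₂ _xor_ Bay (𝓗.Φ-⊥ r⊥a s⊥a (𝓗.coordinates y))))

      cons : (b : Carrier) → Q b ≡ true → B b a ≡ true →
             (∀ i → B (𝓗.r i) b ≡ false) → (∀ i → B (𝓗.s i) b ≡ false) → Hyperbolic (suc n)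
      cons b Qb Bba r⊥b s⊥b = record
        { r     = b Vector.∷ 𝓗.r
        ; s     = a Vector.∷ 𝓗.s
        ; s∈E   = λ { zero → a∈E ; (suc i) → 𝓗.s∈E i }
        ; Q-r   = λ { zero → Qb ; (suc i) → 𝓗.Q-r i }
        ; B-rs  = λ { zero → Bba ; (suc i) → 𝓗.B-rs i }
        ; B-rs′ = λ
          { {zero}  {zero}  0≢0 → contradiction ≡.refl 0≢0
          ; {zero}  {suc j} _   → ≡.trans (B-sym b (𝓗.s j)) (s⊥b j)
          ; {suc i} {zero}  _   → r⊥a i
          ; {suc i} {suc j} i≢j → 𝓗.B-rs′ (i≢j ∘ cong suc)
          }
        ; B-rr  = λ
          { zero    zero    → B-self b
          ; zero    (suc j) → ≡.trans (B-sym b (𝓗.r j)) (r⊥b j)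
          ; (suc i) zero    → r⊥b i
          ; (suc i) (suc j) → 𝓗.B-rr i j
          }
        }

      adjoin : ∀ q → Q y₀ ≡ q → Hyperbolic (suc n)
      adjoin true  Qy₀ = cons y₀ Qy₀ By₀a (𝓗.r⊥remainder y) (𝓗.s⊥remainder y)
      adjoin false Qy₀ = cons (y₀ ∙ a)
        (≡.trans (Q-∙ y₀ a) (cong₂ _xor_ (cong₂ _xor_ Qy₀ (S.singular a∈E)) By₀a))
        (≡.trans (B-∙ˡ y₀ a a) (cong₂ _xor_ By₀a (B-self a)))
        (λ i → ≡.trans (B-∙ʳ _ y₀ a) (cong₂ _xor_ (𝓗.r⊥remainder y i) (r⊥a i)))
        (λ i → ≡.trans (B-∙ʳ _ y₀ a) (cong₂ _xor_ (𝓗.s⊥remainder y i) (s⊥a i)))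

    complete-or-extend : ∀ {n} (𝓗 : Hyperbolic n) → Complete 𝓗 ⊎ Hyperbolic (suc n)
    complete-or-extend 𝓗
      with any-element? {P = λ a → a ∈ member E × (∀ i → B (r 𝓗 i) a ≡ false) × ∃[ y ] B a y ≡ true}
             (λ e (a∈E , r⊥a , y , Bay) → Subgroup.resp E e a∈E
               , (λ i → ≡.trans (B-cong refl (sym e)) (r⊥a i))
               , y , ≡.trans (B-cong (sym e) refl) Bay)
             (λ a → S.decidable a ×-dec Fin.all? (λ i → B (r 𝓗 i) a Bool.≟ false) ×-dec
               any-element? (λ e → ≡.trans (B-cong refl (sym e))) (λ y → B a y Bool.≟ true))
    ... | yes (a , a∈E , r⊥a , y , Bay) = inj₂ (extend 𝓗 a∈E r⊥a Bay)
    ... | no none = inj₁ (λ x∈E r⊥x → nondegenerate (λ y →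
      Bool.¬-not (λ Bxy → none (_ , x∈E , r⊥x , y , Bxy))))

    s-injective : ∀ {n} (𝓗 : Hyperbolic n) {i j} → s 𝓗 i ≈ s 𝓗 j → i ≡ j
    s-injective 𝓗 {i} {j} e with i Fin.≟ j
    ... | yes i≡j = i≡j
    ... | no  i≢j = contradiction
      (≡.trans (≡.sym (B-rs 𝓗 i)) (≡.trans (B-cong refl e) (B-rs′ 𝓗 i≢j))) λ ()

    hyperbolic-bounded : ∀ {n} → Hyperbolic n → n ≤ N
    hyperbolic-bounded 𝓗 = Fin.injective⇒≤ {f = index ∘ s 𝓗}
      (λ e → s-injective 𝓗 (index-injective e))

    -- The s i are distinct, so no system has rank above N. Asking for rank N + 1 therefore returns
    -- a complete system.
    complete-or-large : ∀ n → (∃[ k ] Σ[ 𝓗 ∈ Hyperbolic k ] Complete 𝓗) ⊎ Hyperbolic n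
    complete-or-large zero = inj₂ trivial
    complete-or-large (suc n) with complete-or-large n
    ... | inj₁ found = inj₁ found
    ... | inj₂ 𝓗 with complete-or-extend 𝓗
    ...   | inj₁ complete = inj₁ (n , 𝓗 , complete)
    ...   | inj₂ 𝓗′       = inj₂ 𝓗′

    hyperbolic-basis : ∃[ n ] Σ[ 𝓗 ∈ Hyperbolic n ] Complete 𝓗
    hyperbolic-basis with complete-or-large (suc N)
    ... | inj₁ found = found
    ... | inj₂ 𝓗     = contradiction (hyperbolic-bounded 𝓗) ℕ.1+n≰n

    module _ {n : ℕ} (𝓗 : Hyperbolic n) (complete : Complete 𝓗) where
      open Hyperbolic 𝓗 hiding (Complete; B-rs; B-rs′) renaming (r to ρ; s to σ)

      Φ-coordinates-∈E : ∀ {e} → e ∈ member E → Φ (coordinates e) ∈ member E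
      Φ-coordinates-∈E {e} e∈E = product-∈ E (λ i → Subgroup.resp E
        (sym (trans (∙-congʳ (reflexive (cong (λ b → toℕ (rotation b) ⋆ ρ i)
          (S.isotropic (s∈E i) e∈E)))) (identityˡ (σ i ^ᵇ B (ρ i) e))))
        (power i (B (ρ i) e)))
        where
        power : ∀ i b → σ i ^ᵇ b ∈ member E
        power i false = Subgroup.ε-closed E
        power i true  = s∈E i

      remainder-∈E : ∀ {e} → e ∈ member E → ∃[ b ] remainder e ≈ ζ b
      remainder-∈E {e} e∈E =
        complete (Subgroup.∙-closed E e∈E (Φ-coordinates-∈E e∈E)) (r⊥remainder e)

      -- Modulo the centre e equals Φ of its coordinates, to which every remainder is orthogonal.
      remainder-⊥E : ∀ x {e} → e ∈ member E → B (remainder x) e ≡ false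
      remainder-⊥E x {e} e∈E = from-remainder (remainder-∈E e∈E)
        where
        open ≡.≡-Reasoning renaming (begin_ to begin≡_; _∎ to _∎≡)

        from-remainder : ∃[ b ] remainder e ≈ ζ b → B (remainder x) e ≡ false
        from-remainder (b , eq) = begin≡
          B (remainder x) e
            ≡⟨ Bool.xor-identityʳ _ ⟨
          B (remainder x) e xor false
            ≡⟨ cong (B (remainder x) e xor_) (Φ-⊥ (r⊥remainder x) (s⊥remainder x) (coordinates e)) ⟨
          B (remainder x) e xor B (remainder x) (Φ (coordinates e))
            ≡⟨ B-∙ʳ (remainder x) e _ ⟨
          B (remainder x) (remainder e)
            ≡⟨ B-cong refl eq ⟩
          B (remainder x) (ζ b)
            ≡⟨ B-sym _ (ζ b) ⟩
          B (ζ b) (remainder x)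
            ≡⟨ B-ζˡ b _ ⟩
          false ∎≡

      -- Orthogonality to E puts the remainder into E, where orthogonality to all r i leaves only
      -- central elements. So a basis of E together with its partners spans G modulo Z.
      remainder-central : ∀ x → ∃[ b ] remainder x ≈ ζ b
      remainder-central x = complete (S.maximal (remainder-⊥E x)) (r⊥remainder x)

      decompose : ∀ x → ∃[ b ] x ≈ ζ b ∙ Φ (coordinates x)
      decompose x = divide (Φ (coordinates x)) (remainder-central x)
        where
        divide : ∀ y → ∃[ b ] x ∙ y ≈ ζ b → ∃[ b ] x ≈ ζ b ∙ y
        -- Moving y across multiplies by y² = `ζ (Q y)`, which accounts for the extra bit.
        divide y (b , eq) = Q y xor b , (begin
          x                          ≈⟨ ζ-involutive (Q y) x ⟨
          ζ (Q y) ∙ (ζ (Q y) ∙ x)    ≈⟨ ∙-congˡ (ζ-central (Q y) x) ⟩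
          ζ (Q y) ∙ (x ∙ ζ (Q y))    ≈⟨ ∙-congˡ (∙-congˡ (Q-spec y)) ⟨
          ζ (Q y) ∙ (x ∙ (y ∙ y))    ≈⟨ ∙-congˡ (assoc x y y) ⟨
          ζ (Q y) ∙ (x ∙ y ∙ y)      ≈⟨ ∙-congˡ (∙-congʳ eq) ⟩
          ζ (Q y) ∙ (ζ b ∙ y)        ≈⟨ ζ-xor-∙ (Q y) b y ⟩
          ζ (Q y xor b) ∙ y          ∎)

      central-Φ : ∀ v → (∀ i → ∃[ b ] v i ≡ κ b) →
                  ∃[ b ] Products.product D₈ v ≡ κ b × Φ v ≈ ζ b
      central-Φ v v∈Z = central-product {u = v} (λ i → proj₁ (v∈Z i) , proj₂ (v∈Z i) ,
        trans (reflexive (cong (φ (ρ i) (σ i)) (proj₂ (v∈Z i)))) (φ-κ (Q-r i) (proj₁ (v∈Z i))))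

      ⊥-Φ≈ε : ∀ {v} → Φ v ≈ ε → ∀ w → B w (Φ v) ≡ false
      ⊥-Φ≈ε Φv≈ε w = ≡.trans (B-cong refl Φv≈ε) (≡.trans (B-sym w ε) (B-ζˡ false w))

      Φ≈ε⇒relation : ∀ v → Φ v ≈ ε → v ∈ member (centreRelations D₈ n)
      Φ≈ε⇒relation v Φv≈ε = relation (central-Φ v v∈Z)
        where
        v∈Z : ∀ i → ∃[ b ] v i ≡ κ b
        -- Pairing Φ v with s i and r i recovers both coordinates of v i modulo the centre of D₈.
        v∈Z i = even-rotation (v i) (≡.trans (≡.sym (B-s-Φ i v)) (⊥-Φ≈ε {v} Φv≈ε (σ i)))
                                    (≡.trans (≡.sym (B-r-Φ i v)) (⊥-Φ≈ε {v} Φv≈ε (ρ i)))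

        relation : ∃[ b ] Products.product D₈ v ≡ κ b × Φ v ≈ ζ b →
                   v ∈ member (centreRelations D₈ n)
        relation (b , Πv≡κb , Φv≈ζb) =
          (λ i → Subgroup.resp (centre D₈) (≡.sym (proj₂ (v∈Z i))) (κ-central (proj₁ (v∈Z i)))) ,
          ≡.trans Πv≡κb (cong κ (ζ-injective {b} {false} (trans (sym Φv≈ζb) Φv≈ε)))

      relation⇒Φ≈ε : ∀ v → v ∈ member (centreRelations D₈ n) → Φ v ≈ ε
      relation⇒Φ≈ε v (v∈Z , Πv≡ε) with central-Φ v (λ i → κ-surjective (v i) (v∈Z i))
      ... | b , Πv≡κb , Φv≈ζb = trans Φv≈ζb
        (reflexive (cong ζ (κ-injective {b} {false} (≡.trans (≡.sym Πv≡κb) Πv≡ε))))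

      private module W = CentralPower n

      Φ-divide : ∀ u v → Φ (u W.∙ v W.⁻¹) ∙ Φ v ≈ Φ u
      Φ-divide u v = trans (sym (Φ-homo (u W.∙ v W.⁻¹) v))
        (Φ-cong (λ i → GroupProperties.//-rightDividesˡ D₈ (v i) (u i)))

      Φ-respects : ∀ {u v} → u W.≈ v → Φ u ≈ Φ v
      Φ-respects {u} {v} u≈v = trans (sym (Φ-divide u v))
        (trans (∙-congʳ (relation⇒Φ≈ε (u W.∙ v W.⁻¹) u≈v)) (identityˡ (Φ v)))

      Φ-reflects : ∀ {u v} → Φ u ≈ Φ v → u W.≈ v
      Φ-reflects {u} {v} Φu≈Φv = Φ≈ε⇒relation (u W.∙ v W.⁻¹)
        (∙-cancelʳ (Φ v) _ _ (trans (Φ-divide u v) (trans Φu≈Φv (sym (identityˡ (Φ v))))))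

      Φ-ε : Φ W.ε ≈ ε
      Φ-ε = relation⇒Φ≈ε W.ε (Subgroup.ε-closed (centreRelations D₈ n))

      -- The element z comes from the centre of some factor. For n = 0 the central power is trivial
      -- and Φ misses z, whence the index.
      Φ-hits-ζ : Fin n → ∀ b → ∃[ v ] Φ v ≈ ζ b
      Φ-hits-ζ i b = W.single i (κ b) , trans
        (product-single i (λ j j≢i → trans
          (reflexive (cong (φ (ρ j) (σ j)) (W.single-≢ (κ b) j≢i)))
          (φ-κ {ρ j} {σ j} (Q-r j) false)))
        (trans (reflexive (cong (φ (ρ i) (σ i)) (W.single-≡ i (κ b)))) (φ-κ {ρ i} {σ i} (Q-r i) b))

      Φ-surjective : Fin n → ∀ x → ∃[ v ] Φ v ≈ x
      Φ-surjective i x = translate (coordinates x) (decompose x)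
        where
        translate : ∀ v → ∃[ b ] x ≈ ζ b ∙ Φ v → ∃[ w ] Φ w ≈ x
        translate v (b , x≈) = δ W.∙ v ,
          trans (Φ-homo δ v) (trans (∙-congʳ {Φ v} (proj₂ (Φ-hits-ζ i b))) (sym x≈))
          where δ = proj₁ (Φ-hits-ζ i b)

      -- Φ leads from the central power to G. It respects and reflects equality, so every section of
      -- it inherits the homomorphism laws.
      section⇒isomorphism : (f : Carrier → W.Carrier) → (∀ x → Φ (f x) ≈ x) → G ≅ G⟨ n ,1⟩
      section⇒isomorphism f Φf = f , record
        { isGroupMonomorphism = record
          { isGroupHomomorphism = record
            { isMonoidHomomorphism = record
              { isMagmaHomomorphism = record
                { isRelHomomorphism = record
                  { cong = λ {x} {y} x≈y → Φ-reflects {f x} {f y}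
                      (trans (Φf x) (trans x≈y (sym (Φf y)))) }
                ; homo = λ x y → Φ-reflects {f (x ∙ y)} {f x W.∙ f y}
                    (trans (Φf (x ∙ y)) (sym (trans (Φ-homo (f x) (f y)) (∙-cong (Φf x) (Φf y)))))
                }
              ; ε-homo = Φ-reflects {f ε} {W.ε} (trans (Φf ε) (sym Φ-ε))
              }
            ; ⁻¹-homo = λ x → Φ-reflects {f (x ⁻¹)} {f x W.⁻¹} (trans (Φf (x ⁻¹))
                (sym (inverseˡ-unique _ x (trans (∙-congˡ (sym (Φf x)))
                  (trans (sym (Φ-homo (f x W.⁻¹) (f x)))
                    (trans (Φ-cong (λ i → D.inverseˡ (f x i))) Φ-ε))))))
            }
          ; injective = λ {x} {y} fx≈fy →
              trans (sym (Φf x)) (trans (Φ-respects {f x} {f y} fx≈fy) (Φf y))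
          }
        ; surjective = λ v → Φ v , λ {x} x≈Φv → Φ-reflects {f x} {v} (trans (Φf x) x≈Φv)
        }

      isomorphism : Fin n → G ≅ G⟨ n ,1⟩
      isomorphism i =
        section⇒isomorphism (λ x → proj₁ (Φ-surjective i x)) (λ x → proj₂ (Φ-surjective i x))

      -- A normal form with 2 · 4ⁿ parameters: the digits are recovered by pairing with the basis,
      -- and then the bit by cancellation.
      decode : Bool → (Fin n → Fin 4) → Carrier
      decode b u = ζ b ∙ Φ (quarter ∘ u)

      decode-injective : ∀ {a b u v} → decode a u ≈ decode b v → a ≡ b × (∀ i → u i ≡ v i)
      decode-injective {a} {b} {u} {v} e = ζ-injective (∙-cancelʳ (Φ (quarter ∘ v)) _ _
          (trans (∙-congˡ (Φ-cong (cong quarter ∘ ≡.sym ∘ u≡v))) e)) , u≡v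
        where
        same : ∀ w → B w (Φ (quarter ∘ u)) ≡ B w (Φ (quarter ∘ v))
        same w = ≡.trans (≡.sym (B-V w {decode a u} (ζ⇒V≈ a _)))
          (≡.trans (B-cong refl e) (B-V w {decode b v} (ζ⇒V≈ b _)))

        u≡v : ∀ i → u i ≡ v i
        u≡v i = ≡.trans (≡.sym (quarter⁻¹-quarter (u i))) (≡.trans (cong₂ quarter⁻¹
            (≡.trans (≡.sym (B-s-Φ i (quarter ∘ u))) (≡.trans (same (σ i)) (B-s-Φ i (quarter ∘ v))))
            (≡.trans (≡.sym (B-r-Φ i (quarter ∘ u))) (≡.trans (same (ρ i))
              (B-r-Φ i (quarter ∘ v)))))
          (quarter⁻¹-quarter (v i)))

      decode-surjective : ∀ x → ∃[ b ] ∃[ u ] decode b u ≈ x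
      decode-surjective x = proj₁ (decompose x) , (λ i → quarter⁻¹ (B (σ i) x) (B (ρ i) x)) ,
        trans (∙-congˡ (Φ-cong (λ i → quarter-quarter⁻¹ (B (σ i) x) (B (ρ i) x))))
              (sym (proj₂ (decompose x)))

      order-formula : N ≡ 2 * 4 ^ n
      order-formula = parametrized⇒order decode
        (λ b u≡v → ∙-congˡ (Φ-cong (λ i → cong quarter (u≡v i))))
        decode-injective decode-surjective

-- Matching the rank with m, and the characterization

module _ {c ℓ : Level} {m : ℕ} (1≤m : 1 ≤ m) (G : Group c ℓ) (extraspecial : IsExtraspecial₂ G)
         (order : HasOrder G (2 ^ (2 * m + 1)))
         (S : Extraspecial.SingularLagrangian G extraspecial order) where
  open Extraspecial.Splitting G extraspecial order S

  singularLagrangian⇒isomorphism : G ≅ G⟨ m ,1⟩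
  singularLagrangian⇒isomorphism = from-basis hyperbolic-basis
    where
    at-rank : ∀ {n} → m ≡ n → (Fin n → G ≅ G⟨ n ,1⟩) → G ≅ G⟨ m ,1⟩
    -- As m ≥ 1 there is a factor 0, whose centre supplies z.
    at-rank ≡.refl isomorphic = isomorphic (Fin.fromℕ< 1≤m)

    from-basis : ∃[ n ] Σ[ 𝓗 ∈ Hyperbolic n ] Hyperbolic.Complete 𝓗 → G ≅ G⟨ m ,1⟩
    from-basis (n , 𝓗 , complete) =
      at-rank (exponent-unique m n (order-formula 𝓗 complete)) (isomorphism 𝓗 complete)

theorem1p2 : {c ℓ : Level} (m : ℕ) → 1 ≤ m →
    (G : Group c ℓ) → IsExtraspecial₂ G → HasOrder G (2 ^ (2 * m + 1)) →
    (H : Subgroup G) → Decidable (Subgroup.member H) → IsNontrivial H →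
    IsSubgroupPerfectCode G H ⇔
    ( (¬ IsAbelian H)
    ⊎ (IsAbelian H × ¬ IsNormal H)
    ⊎ (IsMaximalAbelian H × G ≅ G⟨ m ,1⟩))
theorem1p2 m 1≤m G extraspecial order H H? nontrivial = mk⇔ to from
  where
  open Extraspecial G extraspecial order

  Conditions : Set _
  Conditions = (¬ IsAbelian H)
             ⊎ (IsAbelian H × ¬ IsNormal H)
             ⊎ (IsMaximalAbelian H × G ≅ G⟨ m ,1⟩)

  singular : IsLagrangian H × SingularLagrangian → Conditions
  singular (lagrangian , S) = inj₂ (inj₂
    (lagrangian⇒maximalAbelian lagrangian ,
     singularLagrangian⇒isomorphism 1≤m G extraspecial order S))

  to : IsSubgroupPerfectCode G H → Conditions
  to code with H? z | abelian? H H?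
  ... | _       | no nonabelian = inj₁ nonabelian
  ... | no z∉H  | yes abelian   = inj₂ (inj₁
      (abelian , λ normal → z∉H (normal⇒z∈H H nontrivial normal)))
  ... | yes z∈H | yes abelian   = singular (meets⇒lagrangian H H? (z∈H⇒containsCentre H z∈H) abelian
      (perfectCode⇒meets H (z∈H⇒containsCentre H z∈H) code))

  from : Conditions → IsSubgroupPerfectCode G H
  from (inj₁ nonabelian) =
    Transversal.perfectCode H H? (λ _ → nonabelian⇒meets H H? nonabelian)
  from (inj₂ (inj₁ (_ , nonnormal))) =
    -- Subgroups containing z are normal, so the condition on cosets holds vacuously.
    Transversal.perfectCode H H? (λ z∈H → contradiction (z∈H⇒normal H z∈H) nonnormal)
  from (inj₂ (inj₂ (maximal , iso))) =
    Transversal.perfectCode H H? (λ _ → lagrangian⇒meets (isomorphism⇒singularLagrangian iso)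
      H H? (maximalAbelian⇒lagrangian H? maximal))
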